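{- For every positive integer $\ell$ there exists an integer $N(\ell)$ such that every $3$-connected graph $G$ with minimum degree at least $5$, which contains no $K_{2,\ell}$ minor and contains no pair of twins both of degree $5$, has at most $N(\ell)$ vertices.
   Context: All graphs are finite and simple. Two vertices $u,v$ are twins if they have the same closed neighborhood, $N[u]=N[v]$ (in particular they are adjacent). $K_{2,\ell}$ denotes the complete bipartite graph with parts of sizes $2$ and $\ell$. -}

module Defs where

open import Data.Nat using (ℕ; zero; suc; _+_; _≤_; _<_; _<ᵇ_)
open import Data.Bool using (Bool; true; false; if_then_else_; _xor_; _∨_)
open import Data.Fin using (Fin; toℕ)
open import Data.Fin.Properties using () renaming (_≟_ to _≟ᶠ_)
open import Data.List using (List; length; map; allFin)
open import Data.Nat.ListAction using (sum)
open import Data.List.Membership.Propositional using (_∉_)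
open import Data.Maybe using (Maybe; just)
open import Data.Product using (Σ; _×_; ∃)
open import Relation.Binary.PropositionalEquality using (_≡_; _≢_)
open import Relation.Nullary.Decidable using (⌊_⌋)

record Graph (n : ℕ) : Set where
  field
    adj   : Fin n → Fin n → Bool
    irrefl : ∀ v → adj v v ≡ false
    sym   : ∀ u v → adj u v ≡ adj v u
open Graph public

deg : ∀ {n} → Graph n → Fin n → ℕ
deg {n} G v = sum (map (λ w → if adj G v w then 1 else 0) (allFin n))

MinDegAtLeast : ∀ {n} → ℕ → Graph n → Set
MinDegAtLeast k G = ∀ v → k ≤ deg G v

data Reach {n} (G : Graph n) (P : Fin n → Set) : Fin n → Fin n → Set where
  here : ∀ {u} → P u → Reach G P u u
  step : ∀ {u w v} → P u → adj G u w ≡ true → Reach G P w v → Reach G P u v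

ConnectedOn : ∀ {n} → Graph n → (Fin n → Set) → Set
ConnectedOn G P = ∀ u v → P u → P v → Reach G P u v

KConnected : ℕ → ∀ {n} → Graph n → Set
KConnected k {n} G =
  (k < n) × ((X : List (Fin n)) → length X < k → ConnectedOn G (λ w → w ∉ X))

closedAdj : ∀ {n} → Graph n → Fin n → Fin n → Bool
closedAdj G u w = ⌊ u ≟ᶠ w ⌋ ∨ adj G u w

Twins : ∀ {n} → Graph n → Fin n → Fin n → Set
Twins G u v = (u ≢ v) × (∀ w → closedAdj G u w ≡ closedAdj G v w)

-- H is a minor of G, via a minor model (branch sets):
-- β assigns each vertex of G to at most one vertex of H (so branch sets are
-- pairwise disjoint); every branch set is nonempty and induces a connected
-- subgraph of G; every edge of H is realised by an edge of G between the
-- corresponding branch sets.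
record MinorModel {m n} (H : Graph m) (G : Graph n) : Set where
  field
    β         : Fin n → Maybe (Fin m)
    nonempty  : ∀ h → ∃ λ v → β v ≡ just h
    connected : ∀ h → ConnectedOn G (λ v → β v ≡ just h)
    edges     : ∀ h h' → adj H h h' ≡ true →
                Σ (Fin n) λ v → Σ (Fin n) λ v' →
                  (β v ≡ just h) × (β v' ≡ just h') × (adj G v v' ≡ true)

HasMinor : ∀ {m n} → Graph m → Graph n → Set
HasMinor H G = MinorModel H G

private
  inA : ∀ {ℓ} → Fin (2 + ℓ) → Bool
  inA i = toℕ i <ᵇ 2

K2 : (ℓ : ℕ) → Graph (2 + ℓ)
K2 ℓ = record { adj = λ i j → inA i xor inA j ; irrefl = irr ; sym = sy }
  where
  open import Data.Bool.Properties using (xor-same; xor-comm)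
  irr : ∀ v → (inA v xor inA v) ≡ false
  irr v = xor-same (inA v)
  sy : ∀ u v → (inA u xor inA v) ≡ (inA v xor inA u)
  sy u v = xor-comm (inA u) (inA v)

{-# OPTIONS --safe #-}

-- The goal n ≤ N is decidable, so everything below argues classically towards ⊥.
--
-- A K₂,ℓ minor is two disjoint connected sets A, B and ℓ disjoint connected rungs, each touching both.
-- Exclude it in a large G. For a connected set Q and an induced path P off Q with many vertices
-- adjacent to Q, few bridges of P reach Q or bypass a terminal of P, so by 3-connectivity some long
-- window of P is clean: its inner vertices see only Q and P. With Q a single vertex this contradicts
-- minimum degree 5, so degrees are bounded and distances large. Growing a connected set away from a
-- pair of distant vertices yields a long induced path S with G − S connected (Tutte). Since G − S has
-- many vertices adjacent to S, some geodesic of G − S has many of them, and a clean window of it is a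
-- second induced path T. At most 2ℓ vertices of S see both the inside of the window and the rest of G
-- − S. At a vertex s_j seeing only the inside of T, with a nonextreme neighbour t_c, one finds two
-- pairs of S–T edges, one crossing and one parallel, that are loose (do not join consecutive vertices
-- to consecutive vertices): otherwise s_j and t_c are twins of degree 5. A loose pair at one place and
-- another pair further along allow S and T to exchange the segments between them, and the vertices
-- skipped at the loose pair form a rung. Doing this at ℓ disjoint places gives K₂,ℓ.

module Submission where

open import Defs
open import Data.Bool using (Bool; true; false; if_then_else_)
open import Data.Bool.Properties using () renaming (_≟_ to _≟ᵇ_)
open import Data.Empty using (⊥; ⊥-elim)
open import Data.Fin using (Fin; zero; suc; inject≤; fromℕ<)
open import Data.Fin.Properties using (any?; inject≤-injective) renaming (_≟_ to _≟ᶠ_)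
open import Data.List using (List; []; _∷_; _++_; length; map; filter; concatMap; upTo; applyUpTo; allFin; lookup)
open import Data.List.Properties using (length-++; length-map; length-tabulate; length-upTo; length-applyUpTo)
open import Data.List.Membership.Propositional using (_∈_; _∉_; find; lose)
open import Data.List.Membership.Propositional.Properties using (∈-∃++; ∈-++⁺ˡ; ∈-++⁺ʳ; ∈-++⁻; ∈-map⁻; ∈-map⁺; ∈-filter⁺; ∈-filter⁻; ∈-allFin; ∈-upTo⁺; ∈-upTo⁻; ∈-applyUpTo⁻; ∈-lookup; ∈-concatMap⁺)
open import Data.List.Relation.Unary.All using (All; []; _∷_)
import Data.List.Relation.Unary.All as All
open import Data.List.Relation.Unary.AllPairs using (AllPairs; []; _∷_)
import Data.List.Relation.Unary.AllPairs as AllPairs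
import Data.List.Relation.Unary.AllPairs.Properties as AllPairsₚ
open import Data.List.Relation.Unary.Any using (Any; here; there)
import Data.List.Relation.Unary.Any as Any
open import Data.List.Relation.Unary.Unique.Propositional using (Unique)
import Data.List.Relation.Unary.Unique.Propositional.Properties as Uniqueₚ
open import Data.List.Relation.Binary.Sublist.Propositional using (_⊆_; []; _∷_; _∷ʳ_; ⊆-refl; ⊆-trans) renaming (lookup to ⊆-∈)
open import Data.List.Relation.Binary.Sublist.Propositional.Properties using (All-resp-⊆)
open import Data.Maybe using (Maybe; just; nothing)
open import Data.Nat
open import Data.Nat.Properties
open import Data.Product using (Σ; ∃; _×_; _,_; proj₁; proj₂)
open import Data.Sum using (_⊎_; inj₁; inj₂; [_,_]′)
open import Function using (_∘_; id)
open import Relation.Binary.Definitions using (tri<; tri≈; tri>)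
open import Relation.Binary.PropositionalEquality using (_≡_; _≢_; refl; trans; cong; cong₂; subst; subst₂) renaming (sym to ≡-sym)
open import Relation.Nullary using (¬_; Dec; yes; no)
open import Relation.Nullary.Decidable using (_×-dec_)
open import Data.Nat.ListAction using (sum)

-- Classical reasoning towards a contradiction, and selection from finite lists.

lem : (P : Set) → (Dec P → ⊥) → ⊥
lem P κ = κ (no (λ p → κ (yes p)))

finChoice : ∀ {n} (Q : Fin n → Set) → (∀ v → ¬ ¬ Q v) → ¬ ¬ (∀ v → Q v)
finChoice {zero} Q f κ = κ (λ ())
finChoice {suc n} Q f κ =
  f zero λ q → finChoice (λ v → Q (suc v)) (λ v → f (suc v)) λ g →
  κ λ { zero → q ; (suc v) → g v }

decAll : ∀ {n} (P : Fin n → Set) → ¬ ¬ (∀ v → Dec (P v))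
decAll P = finChoice (λ v → Dec (P v)) (λ v → lem (P v))

lastBefore : (P : ℕ → Set) (a : ℕ) → P a → ∀ z → a ≤ z →
  (∀ x → a ≤ x → x ≤ z → P x → (∀ k → x < k → k ≤ z → ¬ P k) → ⊥) → ⊥
lastBefore P a pa z a≤z κ = lem (P z) λ
  { (yes pz) → κ z a≤z ≤-refl pz (λ k z<k k≤z _ → <-irrefl refl (<-≤-trans z<k k≤z))
  ; (no ¬pz) → go z a≤z κ ¬pz }
  where
  go : ∀ z → a ≤ z →
    (∀ x → a ≤ x → x ≤ z → P x → (∀ k → x < k → k ≤ z → ¬ P k) → ⊥) → ¬ P z → ⊥
  go zero z≤n κ ¬pz = ¬pz pa
  go (suc z) a≤z κ ¬pz with m≤n⇒m<n∨m≡n a≤z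
  ... | inj₂ refl = ¬pz pa
  ... | inj₁ (s≤s a≤z′) = lastBefore P a pa z a≤z′ λ x a≤x x≤z px f →
    κ x a≤x (m≤n⇒m≤1+n x≤z) px λ k x<k k≤1+z →
      [ (λ { (s≤s k≤z) → f k x<k k≤z }) , (λ { refl → ¬pz }) ]′ (m≤n⇒m<n∨m≡n k≤1+z)

firstAfter : (P : ℕ → Set) (b : ℕ) → P b → ∀ d z → z + d ≡ b →
  (∀ y → z ≤ y → y ≤ b → P y → (∀ k → z ≤ k → k < y → ¬ P k) → ⊥) → ⊥
firstAfter P b pb zero z e κ rewrite +-identityʳ z =
  κ b (≤-reflexive e) ≤-refl pb (λ k z≤k k<b _ → <-irrefl e (≤-<-trans z≤k k<b))
firstAfter P b pb (suc d) z e κ = lem (P z) λ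
  { (yes pz) → κ z ≤-refl (≤-trans (m≤m+n z (suc d)) (≤-reflexive e)) pz
                 (λ k z≤k k<z _ → <-irrefl refl (≤-<-trans z≤k k<z))
  ; (no ¬pz) → firstAfter P b pb d (suc z) (trans (≡-sym (+-suc z d)) e) λ y z<y y≤b py f →
      κ y (<⇒≤ z<y) y≤b py λ k z≤k k<y →
        [ (λ z<k → f k z<k k<y) , (λ { refl → ¬pz }) ]′ (m≤n⇒m<n∨m≡n z≤k) }

split : {X : Set} (P : X → Set) (xs : List X) →
  (∀ ys zs → ys ⊆ xs → zs ⊆ xs → All P ys → All (λ x → ¬ P x) zs →
     length xs ≡ length ys + length zs → ⊥) → ⊥
split P [] κ = κ [] [] [] [] [] [] refl
split P (x ∷ xs) κ = split P xs λ ys zs s t a b e → lem (P x) λ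
  { (yes p) → κ (x ∷ ys) zs (refl ∷ s) (x ∷ʳ t) (p ∷ a) b (cong suc e)
  ; (no q) → κ ys (x ∷ zs) (x ∷ʳ s) (refl ∷ t) a (q ∷ b)
               (trans (cong suc e) (≡-sym (+-suc (length ys) (length zs)))) }

prune : {X : Set} (P : X → Set) (d k : ℕ) (xs : List X) → d + k ≤ length xs →
  (∀ ys → ys ⊆ xs → All P ys → length ys ≤ d) →
  (∀ zs → zs ⊆ xs → All (λ x → ¬ P x) zs → k ≤ length zs → ⊥) → ⊥
prune P d k xs le few κ = split P xs λ ys zs s t a b e →
  κ zs t b (+-cancelˡ-≤ d k (length zs)
    (≤-trans le (≤-trans (≤-reflexive e) (+-monoˡ-≤ (length zs) (few ys s a)))))

maximal : {X : Set} (μ : X → ℕ) (xs : List X) → 0 < length xs →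
  ∃ λ x → x ∈ xs × (∀ {y} → y ∈ xs → μ y ≤ μ x)
maximal μ (x ∷ []) _ = x , here refl , λ { (here refl) → ≤-refl }
maximal μ (x ∷ x′ ∷ xs) _ with maximal μ (x′ ∷ xs) (s≤s z≤n)
... | m , m∈ , top with ≤-total (μ x) (μ m)
... | inj₁ le = m , there m∈ , λ { (here refl) → le ; (there y∈) → top y∈ }
... | inj₂ ge = x , here refl , λ { (here refl) → ≤-refl ; (there y∈) → ≤-trans (top y∈) ge }

-- Each round picks an `x` of greatest `μ` and discards the at most `d` entries in conflict with it;
-- the `suc` in `suc d` keeps the list nonempty. In most uses `μ` is the left end of an interval and
-- `C x y` says that `y` extends beyond the left end of `x`, so that the outcome is a family of
-- disjoint intervals. In every use `C x x` holds, so no entry is chosen twice.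
greedy : {X : Set} (μ : X → ℕ) (C : X → X → Set) (d k : ℕ) (xs : List X) →
  (∀ {x} → x ∈ xs → ∀ ys → ys ⊆ xs → All (λ y → μ y ≤ μ x × C x y) ys → length ys ≤ d) →
  k * suc d ≤ length xs →
  (∀ ys → length ys ≡ k → All (_∈ xs) ys → AllPairs (λ x y → μ y ≤ μ x × ¬ C x y) ys → ⊥) → ⊥
greedy μ C d zero xs few le κ = κ [] refl [] []
greedy μ C d (suc k) xs few le κ with maximal μ xs (≤-trans (s≤s z≤n) le)
... | x , x∈ , top =
  prune (C x) d (k * suc d) xs (≤-trans (n≤1+n _) le)
    (λ ys s a → few x∈ ys s
      (All.tabulate λ y∈ → top (⊆-∈ s y∈) , All.lookup a y∈)) λ zs s a le′ →
  greedy μ C d k zs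
    (λ z∈ ys t → few (⊆-∈ s z∈) ys (⊆-trans t s)) le′ λ ys e ys∈ ap →
  κ (x ∷ ys) (cong suc e) (x∈ ∷ All.map (⊆-∈ s) ys∈)
    (All.map (λ y∈ → top (⊆-∈ s y∈) , All.lookup a y∈) ys∈ ∷ ap)

-- Inequivalent elements are added while there is a new one. By `many` their number cannot reach
-- `b`, so the process stops with representatives for everything.
exhaust : {X : Set} (_≈_ : X → X → Set) (b : ℕ) →
  (∀ xs → length xs ≡ b → AllPairs (λ x y → ¬ (x ≈ y)) xs → ⊥) →
  (∀ xs → length xs ≤ b → (∀ y → ¬ ¬ (∃ λ x → x ∈ xs × (y ≈ x))) → ⊥) → ⊥
exhaust {X} _≈_ b many few = go b [] z≤n [] (+-identityʳ b)
  where
  go : ∀ d xs → length xs ≤ b → AllPairs (λ x y → ¬ (x ≈ y)) xs → d + length xs ≡ b → ⊥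
  go zero xs le ap e = many xs e ap
  go (suc d) xs le ap e = lem (∃ λ y → ∀ {x} → x ∈ xs → ¬ (y ≈ x)) λ
    { (yes (y , new)) → go d (y ∷ xs) (≤-trans (m≤n+m _ d) (≤-reflexive (trans (+-suc d _) e)))
                          (All.tabulate new ∷ ap) (trans (+-suc d _) e)
    ; (no old) → few xs le λ y none → old (y , λ x∈ y≈x → none (_ , x∈ , y≈x)) }

AllPairs-resp-⊆ : {X : Set} {R : X → X → Set} {xs ys : List X} → xs ⊆ ys → AllPairs R ys → AllPairs R xs
AllPairs-resp-⊆ [] [] = []
AllPairs-resp-⊆ (_ ∷ʳ s) (_ ∷ r) = AllPairs-resp-⊆ s r
AllPairs-resp-⊆ (refl ∷ s) (a ∷ r) = All-resp-⊆ s a ∷ AllPairs-resp-⊆ s r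

AllPairs-map-∈ : {X : Set} {R S : X → X → Set} (xs : List X) →
  (∀ {x y} → x ∈ xs → y ∈ xs → R x y → S x y) → AllPairs R xs → AllPairs S xs
AllPairs-map-∈ [] f [] = []
AllPairs-map-∈ (x ∷ xs) f (a ∷ r) =
  All.tabulate (λ y∈ → f (here refl) (there y∈) (All.lookup a y∈)) ∷
  AllPairs-map-∈ xs (λ x∈ y∈ → f (there x∈) (there y∈)) r

AllPairs⇒≡∨ : {X : Set} {S : X → X → Set} (xs : List X) → (∀ {x y} → S x y → S y x) →
  AllPairs S xs → ∀ {x y} → x ∈ xs → y ∈ xs → x ≡ y ⊎ S x y
AllPairs⇒≡∨ (_ ∷ xs) S-sym (a ∷ r) (here refl) (here refl) = inj₁ refl
AllPairs⇒≡∨ (_ ∷ xs) S-sym (a ∷ r) (here refl) (there y∈) = inj₂ (All.lookup a y∈)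
AllPairs⇒≡∨ (_ ∷ xs) S-sym (a ∷ r) (there x∈) (here refl) = inj₂ (S-sym (All.lookup a x∈))
AllPairs⇒≡∨ (_ ∷ xs) S-sym (a ∷ r) (there x∈) (there y∈) = AllPairs⇒≡∨ xs S-sym r x∈ y∈

unique-length : {X : Set} {xs : List X} (ys : List X) → Unique xs → (∀ {x} → x ∈ xs → x ∈ ys) →
  length xs ≤ length ys
unique-length {xs = []} ys u sub = z≤n
unique-length {xs = x ∷ xs} ys (a ∷ u) sub with ∈-∃++ (sub (here refl))
... | as , bs , refl = ≤-trans (s≤s (unique-length (as ++ bs) u rest)) (≤-reflexive eq)
  where
  eq : suc (length (as ++ bs)) ≡ length (as ++ x ∷ bs)
  eq = trans (cong suc (length-++ as)) (trans (≡-sym (+-suc (length as) (length bs))) (≡-sym (length-++ as)))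
  rest : ∀ {y} → y ∈ xs → y ∈ as ++ bs
  rest y∈ with ∈-++⁻ as (sub (there y∈))
  ... | inj₁ y∈as = ∈-++⁺ˡ y∈as
  ... | inj₂ (here refl) = ⊥-elim (All.lookup a y∈ refl)
  ... | inj₂ (there y∈bs) = ∈-++⁺ʳ as y∈bs

AllPairs-lookup : {X : Set} {S : X → X → Set} (xs : List X) → (∀ {x y} → S x y → S y x) →
  AllPairs S xs → ∀ i j → i ≢ j → S (lookup xs i) (lookup xs j)
AllPairs-lookup (x ∷ xs) S-sym (a ∷ r) zero zero i≢j = ⊥-elim (i≢j refl)
AllPairs-lookup (x ∷ xs) S-sym (a ∷ r) zero (suc j) i≢j = All.lookup a (∈-lookup j)
AllPairs-lookup (x ∷ xs) S-sym (a ∷ r) (suc i) zero i≢j = S-sym (All.lookup a (∈-lookup i))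
AllPairs-lookup (x ∷ xs) S-sym (a ∷ r) (suc i) (suc j) i≢j =
  AllPairs-lookup xs S-sym r i j (i≢j ∘ cong suc)

-- Reachability, minors from branch sets, and degrees.

module Basics {n : ℕ} (G : Graph n) where

  V : Set
  V = Fin n

  E : V → V → Set
  E u v = adj G u v ≡ true

  E? : ∀ u v → Dec (E u v)
  E? u v = adj G u v ≟ᵇ true

  E-sym : ∀ {u v} → E u v → E v u
  E-sym {u} {v} e = trans (Defs.sym G v u) e

  E-irrefl : ∀ {u} → ¬ E u u
  E-irrefl {u} e with trans (≡-sym (irrefl G u)) e
  ... | ()

  Conn : (V → Set) → Set
  Conn = ConnectedOn G

  Sees : (V → Set) → (V → Set) → Set
  Sees P Q = ∃ λ a → ∃ λ b → P a × Q b × E a b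

  Disj : (V → Set) → (V → Set) → Set
  Disj P Q = ∀ v → P v → Q v → ⊥

  Disj-sym : ∀ {P Q} → Disj P Q → Disj Q P
  Disj-sym d v q p = d v p q

  R-left : ∀ {P u v} → Reach G P u v → P u
  R-left (here p) = p
  R-left (step p _ _) = p

  R-right : ∀ {P u v} → Reach G P u v → P v
  R-right (here p) = p
  R-right (step _ _ r) = R-right r

  R-trans : ∀ {P u v w} → Reach G P u v → Reach G P v w → Reach G P u w
  R-trans (here _) s = s
  R-trans (step p e r) s = step p e (R-trans r s)

  R-snoc : ∀ {P u v w} → Reach G P u v → E v w → P w → Reach G P u w
  R-snoc r e p = R-trans r (step (R-right r) e (here p))

  R-sym : ∀ {P u v} → Reach G P u v → Reach G P v u
  R-sym (here p) = here p
  R-sym (step p e r) = R-snoc (R-sym r) (E-sym e) p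

  R-map : ∀ {P Q : V → Set} {u v} → (∀ {x} → P x → Q x) → Reach G P u v → Reach G Q u v
  R-map f (here p) = here (f p)
  R-map f (step p e r) = step (f p) e (R-map f r)

  R-inside : ∀ {P u v} → Reach G P u v → Reach G (Reach G P u) u v
  R-inside (here p) = here (here p)
  R-inside (step p e r) = step (here p) e (R-map (step p e) (R-inside r))

  comp-conn : ∀ {P c} → Conn (Reach G P c)
  comp-conn u v ru rv = R-trans (R-sym (R-inside ru)) (R-inside rv)

  conn-via : ∀ {P : V → Set} c → (∀ {v} → P v → Reach G P c v) → Conn P
  conn-via c f u v pu pv = R-trans (R-sym (f pu)) (f pv)

  -- Branch sets given as predicates become a labelling once membership is decided, which finiteness
  -- permits under a double negation. Disjointness leaves only one possible label for a vertex.
  minor-of-sets : ∀ {m} (H : Graph m) (S : Fin m → V → Set) →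
    (∀ h → ∃ (S h)) → (∀ h → Conn (S h)) → (∀ h k → h ≢ k → Disj (S h) (S k)) →
    (∀ h k → adj H h k ≡ true → Sees (S h) (S k)) → ¬ ¬ HasMinor H G
  minor-of-sets {m} H S ne conn disj sees κ =
    finChoice (λ v → ∀ h → Dec (S h v)) (λ v → decAll (λ h → S h v)) λ S? →
    κ (model S?)
    where
    model : (∀ v h → Dec (S h v)) → HasMinor H G
    model S? = record
      { β = λ v → label (any? (S? v))
      ; nonempty = λ h → proj₁ (ne h) , into (proj₂ (ne h)) (any? (S? (proj₁ (ne h))))
      ; connected = λ h u v bu bv →
          R-map (λ {x} s → into s (any? (S? x))) (conn h u v (out (any? (S? u)) bu) (out (any? (S? v)) bv))
      ; edges = λ h k e → let (u , v , su , sv , uv) = sees h k e in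
          u , v , into su (any? (S? u)) , into sv (any? (S? v)) , uv }
      where
      label : ∀ {v} → Dec (∃ λ h → S h v) → Maybe (Fin m)
      label (yes (h , _)) = just h
      label (no _) = nothing
      into : ∀ {h v} → S h v → (d : Dec (∃ λ h → S h v)) → label d ≡ just h
      into {h} {v} s (no ¬s) = ⊥-elim (¬s (h , s))
      into {h} {v} s (yes (k , t)) with h ≟ᶠ k
      ... | yes refl = refl
      ... | no h≢k = ⊥-elim (disj h k h≢k v s t)
      out : ∀ {h v} → (d : Dec (∃ λ h → S h v)) → label d ≡ just h → S h v
      out (yes (k , t)) refl = t

  record Rung (A B R : V → Set) : Set where
    constructor rung
    field
      R-conn : Conn R
      R-A : Sees R A
      R-B : Sees R B
      A-disj : Disj A R
      B-disj : Disj B R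

  Sees-sym : ∀ {P Q} → Sees P Q → Sees Q P
  Sees-sym (a , b , p , q , e) = b , a , q , p , E-sym e

  -- The form in which the excluded minor is applied throughout. As `1 ≤ ℓ`, there would be a first
  -- rung, and its contacts show that the branch sets `A` and `B` are nonempty.
  K2-minor : ∀ {ℓ} → 1 ≤ ℓ → ¬ HasMinor (K2 ℓ) G →
    {X : Set} (A B : V → Set) (R : X → V → Set) (xs : List X) →
    Conn A → Conn B → Disj A B →
    (∀ {x} → x ∈ xs → Rung A B (R x)) →
    AllPairs (λ x y → Disj (R x) (R y)) xs →
    length xs < ℓ
  K2-minor {suc ℓ} (s≤s z≤n) noK A B R xs cA cB dAB rungs ap = ≰⇒> λ ℓ≤ →
    minor-of-sets (K2 (suc ℓ)) (S ℓ≤) (ne ℓ≤) (conn ℓ≤) (disj ℓ≤) (sees ℓ≤) noK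
    where
    module _ (ℓ≤ : suc ℓ ≤ length xs) where
      item : Fin (suc ℓ) → _
      item i = lookup xs (inject≤ i ℓ≤)
      rg : ∀ i → Rung A B (R (item i))
      rg i = rungs (∈-lookup (inject≤ i ℓ≤))
      S : Fin (2 + suc ℓ) → V → Set
      S zero = A
      S (suc zero) = B
      S (suc (suc i)) = R (item i)
      ne : ∀ h → ∃ (S h)
      ne zero = let (_ , a , _ , p , _) = Rung.R-A (rg zero) in a , p
      ne (suc zero) = let (_ , b , _ , p , _) = Rung.R-B (rg zero) in b , p
      ne (suc (suc i)) = let (r , _ , p , _) = Rung.R-A (rg i) in r , p
      conn : ∀ h → Conn (S h)
      conn zero = cA
      conn (suc zero) = cB
      conn (suc (suc i)) = Rung.R-conn (rg i)
      disj : ∀ h k → h ≢ k → Disj (S h) (S k)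
      disj zero zero h≢k = ⊥-elim (h≢k refl)
      disj zero (suc zero) _ = dAB
      disj zero (suc (suc i)) _ = Rung.A-disj (rg i)
      disj (suc zero) zero _ = Disj-sym {A} dAB
      disj (suc zero) (suc zero) h≢k = ⊥-elim (h≢k refl)
      disj (suc zero) (suc (suc i)) _ = Rung.B-disj (rg i)
      disj (suc (suc i)) zero _ = Disj-sym {A} (Rung.A-disj (rg i))
      disj (suc (suc i)) (suc zero) _ = Disj-sym {B} (Rung.B-disj (rg i))
      disj (suc (suc i)) (suc (suc j)) h≢k =
        AllPairs-lookup xs (λ {x} {y} → Disj-sym {R x}) ap _ _
          (λ e → h≢k (cong (λ i → suc (suc i)) (inject≤-injective ℓ≤ ℓ≤ i j e)))
      sees : ∀ h k → adj (K2 (suc ℓ)) h k ≡ true → Sees (S h) (S k)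
      sees zero (suc (suc i)) _ = Sees-sym (Rung.R-A (rg i))
      sees (suc zero) (suc (suc i)) _ = Sees-sym (Rung.R-B (rg i))
      sees (suc (suc i)) zero _ = Rung.R-A (rg i)
      sees (suc (suc i)) (suc zero) _ = Rung.R-B (rg i)
      sees zero zero ()
      sees zero (suc zero) ()
      sees (suc zero) zero ()
      sees (suc zero) (suc zero) ()
      sees (suc (suc i)) (suc (suc j)) ()

  nbrs : V → List V
  nbrs v = filter (E? v) (allFin n)

  deg-nbrs : ∀ v → deg G v ≡ length (nbrs v)
  deg-nbrs v = count (allFin n)
    where
    count : ∀ xs → sum (map (λ w → if adj G v w then 1 else 0) xs) ≡ length (filter (E? v) xs)
    count [] = refl
    count (w ∷ xs) with adj G v w
    ... | true = cong suc (count xs)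
    ... | false = count xs

  ∈-nbrs : ∀ {u v} → E u v → v ∈ nbrs u
  ∈-nbrs {u} {v} e = ∈-filter⁺ (E? u) (∈-allFin v) e

  nbrs-E : ∀ {u v} → v ∈ nbrs u → E u v
  nbrs-E {u} v∈ = proj₂ (∈-filter⁻ (E? u) {xs = allFin n} v∈)

  nbrs-unique : ∀ v → Unique (nbrs v)
  nbrs-unique v = Uniqueₚ.filter⁺ (E? v) (Uniqueₚ.allFin⁺ n)

  deg-cover : ∀ {v} xs → (∀ {w} → E v w → w ∈ xs) → deg G v ≤ length xs
  deg-cover {v} xs f = ≤-trans (≤-reflexive (deg-nbrs v)) (unique-length xs (nbrs-unique v) (f ∘ nbrs-E))

-- Induced paths, rerouting along detours, bridges and pockets.

module Paths {n : ℕ} (G : Graph n) where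
  open Basics G

  Seg : (ℕ → V) → ℕ → ℕ → V → Set
  Seg p i j v = ∃ λ k → i ≤ k × k < j × v ≡ p k

  Steps : (ℕ → V) → ℕ → Set
  Steps p N = ∀ k → suc k < N → E (p k) (p (suc k))

  walk : ∀ {A : V → Set} {p N} → Steps p N → ∀ i k → i ≤ k → k < N →
    (∀ j → i ≤ j → j ≤ k → A (p j)) → Reach G A (p i) (p k)
  walk st i zero z≤n lt f = here (f 0 z≤n z≤n)
  walk st i (suc k) i≤ lt f with m≤n⇒m<n∨m≡n i≤
  ... | inj₂ refl = here (f _ ≤-refl ≤-refl)
  ... | inj₁ (s≤s i≤k) =
    R-snoc (walk st i k i≤k (<-trans (n<1+n k) lt) (λ j i≤j j≤k → f j i≤j (m≤n⇒m≤1+n j≤k)))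
      (st k lt) (f (suc k) i≤ ≤-refl)

  seg-conn : ∀ {p N} → Steps p N → ∀ i j → j ≤ N → Conn (Seg p i j)
  seg-conn {p} st i j j≤N = conn-via (p i) λ
    { (k , i≤k , k<j , refl) → walk st i k i≤k (<-≤-trans k<j j≤N)
        (λ m i≤m m≤k → m , i≤m , ≤-<-trans m≤k k<j , refl) }

  record Path : Set where
    field
      at : ℕ → V
      len : ℕ
      steps : Steps at len
      inj : ∀ {i j} → i < len → j < len → at i ≡ at j → i ≡ j
      induced : ∀ {i j} → i < len → j < len → E (at i) (at j) → j ≡ suc i ⊎ i ≡ suc j

  PathNbr : Path → ℕ → V → Set
  PathNbr P k v = ∃ λ j → j < Path.len P × v ≡ Path.at P j × (j ≡ suc k ⊎ k ≡ suc j)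

  module Reroute {X : Set} (p : ℕ → V) (N : ℕ) (lo hi : X → ℕ) (xs : List X) (D : X → V → Set) where

    Apart : X → X → Set
    Apart x y = hi x ≤ lo y ⊎ hi y ≤ lo x

    Apart-sym : ∀ {x y} → Apart x y → Apart y x
    Apart-sym (inj₁ a) = inj₂ a
    Apart-sym (inj₂ a) = inj₁ a

    Outside : ℕ → Set
    Outside k = ∀ {x} → x ∈ xs → lo x < k → k < hi x → ⊥

    -- The path p with every open interval (lo x , hi x) replaced by the detour D x.
    Rail : V → Set
    Rail v = (∃ λ k → k < N × Outside k × v ≡ p k) ⊎ (∃ λ x → x ∈ xs × D x v)

    module _ (lo<hi : ∀ {x} → x ∈ xs → lo x < hi x) (ap : AllPairs Apart xs) where

      lo-outside : ∀ {x} → x ∈ xs → Outside (lo x)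
      lo-outside x∈ y∈ l h with AllPairs⇒≡∨ xs Apart-sym ap x∈ y∈
      ... | inj₁ refl = <-irrefl refl l
      ... | inj₂ (inj₁ le) = <-asym (<-≤-trans (lo<hi x∈) le) l
      ... | inj₂ (inj₂ le) = <⇒≱ h le

      hi-outside : ∀ {x} → x ∈ xs → Outside (hi x)
      hi-outside x∈ y∈ l h with AllPairs⇒≡∨ xs Apart-sym ap x∈ y∈
      ... | inj₁ refl = <-irrefl refl h
      ... | inj₂ (inj₁ le) = <⇒≱ l le
      ... | inj₂ (inj₂ le) = <-asym (≤-<-trans le (lo<hi x∈)) h

      -- Every rail vertex is joined to `p 0` by walking back. If the preceding position lies inside
      -- an interval, the current one is the right end of that interval, and the detour leads to its
      -- left end, which is on the rail because the intervals are apart.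
      rail-conn : Steps p N → (∀ {x} → x ∈ xs → hi x < N) →
        (∀ {x} → x ∈ xs → Conn (D x)) →
        (∀ {x} → x ∈ xs → ∃ λ e → D x e × E (p (lo x)) e) →
        (∀ {x} → x ∈ xs → ∃ λ e → D x e × E (p (hi x)) e) →
        Conn Rail
      rail-conn st hi<N D-conn loD hiD = conn-via (p 0) λ
        { (inj₁ (k , k<N , out , refl)) → reach k k ≤-refl k<N out
        ; (inj₂ (x , x∈ , d)) → detour x∈ d (reach _ (lo x) ≤-refl (lo<N x∈) (lo-outside x∈)) }
        where
        lo<N : ∀ {x} → x ∈ xs → lo x < N
        lo<N x∈ = <-trans (lo<hi x∈) (hi<N x∈)
        detour : ∀ {x v} → x ∈ xs → D x v → Reach G Rail (p 0) (p (lo x)) → Reach G Rail (p 0) v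
        detour {x} x∈ d r with loD x∈
        ... | e , de , pe = R-trans (R-snoc r pe (inj₂ (x , x∈ , de)))
                              (R-map (λ d′ → inj₂ (x , x∈ , d′)) (D-conn x∈ _ _ de d))
        -- `b` bounds the recursion, since a detour leads from `hi x` back to `lo x` and not to the
        -- preceding position.
        reach : ∀ b k → k ≤ b → k < N → Outside k → Reach G Rail (p 0) (p k)
        reach b zero _ k<N out = here (inj₁ (0 , k<N , out , refl))
        reach (suc b) (suc k) (s≤s k≤b) k<N out with Any.any? (λ x → (lo x <? k) ×-dec (k <? hi x)) xs
        ... | no none = R-snoc (reach b k k≤b (<-trans (n<1+n k) k<N) (λ x∈ l h → none (lose x∈ (l , h))))
                          (st k k<N) (inj₁ (suc k , k<N , out , refl))
        ... | yes some with find some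
        ... | x , x∈ , l , h with m≤n⇒m<n∨m≡n h
        ... | inj₁ h′ = ⊥-elim (out x∈ (m<n⇒m<1+n l) h′)
        ... | inj₂ 1+k≡hi with hiD x∈
        ... | e , de , pe =
          R-snoc (detour x∈ de (reach b (lo x) (≤-trans (<⇒≤ l) k≤b) (lo<N x∈) (lo-outside x∈)))
            (subst (E e) (cong p (≡-sym 1+k≡hi)) (E-sym pe)) (inj₁ (suc k , k<N , out , refl))

  -- A walk from `a` to `b` missing `x` and `y` would stay in `U` at every step, yet `b` is outside.
  separates : KConnected 3 G → (U : V → Set) (x y : V) {a b : V} → U a → ¬ U b →
    a ≢ x → a ≢ y → b ≢ x → b ≢ y →
    (∀ {u w} → U u → E u w → w ≢ x → w ≢ y → ¬ ¬ U w) → ⊥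
  separates (_ , k3) U x y {a} {b} Ua ¬Ub ax ay bx by close =
    go (k3 (x ∷ y ∷ []) (s≤s (s≤s (s≤s z≤n))) a b (avoid ax ay) (avoid bx by)) Ua
    where
    avoid : ∀ {v} → v ≢ x → v ≢ y → v ∉ x ∷ y ∷ []
    avoid vx vy (here e) = vx e
    avoid vx vy (there (here e)) = vy e
    go : ∀ {u} → Reach G (_∉ x ∷ y ∷ []) u b → U u → ⊥
    go (here _) Uu = ¬Ub Uu
    go (step _ e r) Uu = close Uu e
      (λ w≡x → R-left r (here w≡x)) (λ w≡y → R-left r (there (here w≡y))) (go r)

  module Bridges (P : Path) (Q : V → Set) where
    open Path P

    On : V → Set
    On = Seg at 0 len

    Rest : V → Set
    Rest v = ¬ Q v × ¬ On v

    -- A bridge is a component of `Rest`, represented by any vertex `c` in it; this predicate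
    -- depends only on the component.
    Attach : V → ℕ → Set
    Attach c k = ∃ λ w → Reach G Rest c w × E w (at k)

    AttachQ : V → Set
    AttachQ c = ∃ λ w → ∃ λ q → Reach G Rest c w × Q q × E w q

    Terminal : ℕ → Set
    Terminal k = ∃ λ q → Q q × E (at k) q

    Enclosed : ℕ → ℕ → V → Set
    Enclosed x y v = Rest v × (∀ k → k < len → Attach v k → x ≤ k × k ≤ y) × ¬ AttachQ v

    -- By 3-connectivity at x and at y cannot cut the open interval (x , y), together with
    -- the bridges enclosed in it, off from Q.
    no-pocket : KConnected 3 G → (∀ k → k < len → ¬ Q (at k)) → ∃ Q →
      ∀ x y → x ≤ y → y < len →
      (∀ k → x < k → k < y → ¬ Terminal k) →
      (∀ k → x < k → k < y → ∀ v → Rest v → Attach v k → Enclosed x y v) →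
      ∀ a → ¬ (Seg at (suc x) y a ⊎ Enclosed x y a)
    no-pocket k3 off (b , Qb) x y x≤y y<len noT enc a Ua =
      separates k3 U (at x) (at y) Ua ¬Ub (≢end x<len (inj₁ refl) Ua) (≢end y<len (inj₂ refl) Ua)
        (λ { refl → off x x<len Qb }) (λ { refl → off y y<len Qb }) close
      where
      U : V → Set
      U v = Seg at (suc x) y v ⊎ Enclosed x y v
      x<len : x < len
      x<len = ≤-<-trans x≤y y<len
      ≢end : ∀ {z v} → z < len → (z ≡ x ⊎ z ≡ y) → U v → v ≢ at z
      ≢end z<len z≡ (inj₁ (k , x<k , k<y , refl)) e with inj (<-trans k<y y<len) z<len e
      ... | refl = [ (λ { refl → <-irrefl refl x<k }) , (λ { refl → <-irrefl refl k<y }) ]′ z≡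
      ≢end {z} z<len z≡ (inj₂ ((_ , off) , _)) e = off (z , z≤n , z<len , e)
      ¬Ub : ¬ U b
      ¬Ub (inj₁ (k , _ , k<y , refl)) = off k (<-trans k<y y<len) Qb
      ¬Ub (inj₂ ((¬Q , _) , _)) = ¬Q Qb
      inside : ∀ {m} → m < len → x ≤ m → m ≤ y → at m ≢ at x → at m ≢ at y → U (at m)
      inside m<len x≤m m≤y mx my =
        inj₁ (_ , ≤∧≢⇒< x≤m (λ { refl → mx refl }) , ≤∧≢⇒< m≤y (λ { refl → my refl }) , refl)
      close : ∀ {u w} → U u → E u w → w ≢ at x → w ≢ at y → ¬ ¬ U w
      close {u} {w} Uu e wx wy κ = lem (Q w) λ
        { (yes Qw) → toQ Uu Qw
        ; (no ¬Qw) → lem (On w) λ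
            { (yes (m , _ , m<len , w≡)) → toP m<len Uu w≡
            ; (no ¬On) → toR Uu (¬Qw , ¬On) } }
        where
        toQ : U u → Q w → ⊥
        toQ (inj₁ (k , x<k , k<y , refl)) Qw = noT k x<k k<y (w , Qw , e)
        toQ (inj₂ (Ru , _ , ¬AQ)) Qw = ¬AQ (u , w , here Ru , Qw , e)
        toP : ∀ {m} → m < len → U u → w ≡ at m → ⊥
        toP m<len (inj₂ (Ru , enc′ , _)) refl with enc′ _ m<len (u , here Ru , e)
        ... | x≤m , m≤y = κ (inside m<len x≤m m≤y wx wy)
        -- As `P` is induced, the edge leads to a neighbouring position, which is inside the
        -- interval or one of its ends.
        toP m<len (inj₁ (k , x<k , k<y , refl)) refl with induced (<-trans k<y y<len) m<len e
        ... | inj₁ refl = κ (inside m<len (m≤n⇒m≤1+n (<⇒≤ x<k)) k<y wx wy)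
        ... | inj₂ refl = κ (inside m<len (≤-pred x<k) (≤-trans (n≤1+n _) (<⇒≤ k<y)) wx wy)
        toR : U u → Rest w → ⊥
        toR (inj₁ (k , x<k , k<y , refl)) Rw = κ (inj₂ (enc k x<k k<y w Rw (w , here Rw , E-sym e)))
        toR (inj₂ (Ru , enc′ , ¬AQ)) Rw = κ (inj₂ (Rw ,
          (λ { m m<len (z , r , ez) → enc′ m m<len (z , step Ru e r , ez) }) ,
          (λ { (z , q , r , Qq , ez) → ¬AQ (z , q , step Ru e r , Qq , ez) })))

-- Geodesics, balls, and geodesics with many terminals.

module Geodesics {n : ℕ} (G : Graph n) where
  open Basics G
  open Paths G

  module From (K : V → Set) (r : V) where

    -- `K` is asked of every vertex but the root, so that distances make sense before `r` is known
    -- to lie in `K`.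
    Walk : ℕ → V → Set
    Walk zero v = v ≡ r
    Walk (suc d) v = K v × ∃ λ u → Walk d u × E u v

    Dist : ℕ → V → Set
    Dist d v = Walk d v × (∀ d′ → d′ < d → ¬ Walk d′ v)

    reach-walk : ∀ {d u v} → Walk d u → Reach G K u v → ∃ λ d′ → Walk d′ v
    reach-walk w (here _) = _ , w
    reach-walk w (step _ e s) = reach-walk (R-left s , _ , w , e) s

    reach-dist : ∀ {v} → Reach G K r v → ¬ ¬ (∃ λ d → Dist d v)
    reach-dist s κ with reach-walk {0} refl s
    ... | d , w = firstAfter (λ k → Walk k _) d w d 0 refl λ y _ _ wy f →
      κ (y , wy , λ d′ d′<y → f d′ z≤n d′<y)

    dist-unique : ∀ {d d′ v} → Dist d v → Dist d′ v → d ≡ d′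
    dist-unique {d} {d′} (w , f) (w′ , f′) with <-cmp d d′
    ... | tri< d<d′ _ _ = ⊥-elim (f′ d d<d′ w)
    ... | tri≈ _ e _ = e
    ... | tri> _ _ d′<d = ⊥-elim (f d′ d′<d w′)

    dist-pred : ∀ {d v} → Dist (suc d) v → ∃ λ u → Dist d u × E u v
    dist-pred ((Kv , u , w , e) , f) =
      u , (w , λ d′ d′<d w′ → f (suc d′) (s≤s d′<d) (Kv , u , w′ , e)) , e

    record Geodesic (v : V) (d : ℕ) (p : ℕ → V) : Set where
      field
        end : p d ≡ v
        dist : ∀ k → k ≤ d → Dist k (p k)
        steps : Steps p (suc d)

    extend : ℕ → (ℕ → V) → V → ℕ → V
    extend d p v k with k ≤? d
    ... | yes _ = p k
    ... | no _ = v

    extend-≤ : ∀ {d p v k} → k ≤ d → extend d p v k ≡ p k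
    extend-≤ {d} {k = k} le with k ≤? d
    ... | yes _ = refl
    ... | no ¬le = ⊥-elim (¬le le)

    extend-> : ∀ {d p v} → extend d p v (suc d) ≡ v
    extend-> {d} with suc d ≤? d
    ... | yes le = ⊥-elim (1+n≰n le)
    ... | no _ = refl

    geodesic : ∀ d {v} → Dist d v → ∃ λ p → Geodesic v d p
    geodesic zero {v} D = (λ _ → v) , record
      { end = refl ; dist = λ { zero z≤n → D } ; steps = λ { k (s≤s ()) } }
    geodesic (suc d) {v} D with dist-pred D
    ... | u , Du , e with geodesic d Du
    ... | p , g = extend d p v , record
      { end = extend-> {d} {p}
      ; dist = λ k k≤ → [ (λ { (s≤s k≤d) → subst (Dist k) (≡-sym (extend-≤ k≤d)) (Geodesic.dist g k k≤d) })
                        , (λ { refl → subst (Dist k) (≡-sym (extend-> {d} {p})) D }) ]′ (m≤n⇒m<n∨m≡n k≤)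
      ; steps = λ { k (s≤s k<1+d) → st k k<1+d (m≤n⇒m<n∨m≡n k<1+d) } }
      where
      st : ∀ k → suc k ≤ suc d → suc k < suc d ⊎ suc k ≡ suc d → E (extend d p v k) (extend d p v (suc k))
      st k (s≤s k≤d) (inj₁ (s≤s k<d)) =
        subst₂ E (≡-sym (extend-≤ k≤d)) (≡-sym (extend-≤ k<d)) (Geodesic.steps g k (s≤s k<d))
      st k (s≤s k≤d) (inj₂ refl) =
        subst₂ E (≡-sym (trans (extend-≤ k≤d) (Geodesic.end g))) (≡-sym (extend-> {d} {p})) e

    module _ (Kr : K r) where

      dist-K : ∀ {d v} → Dist d v → K v
      dist-K {zero} (refl , _) = Kr
      dist-K {suc d} ((Kv , _) , _) = Kv

      -- The distance from `r` determines the position of a vertex and changes by at most one along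
      -- an edge within `K`; hence there are no repetitions and no chords.
      geodesic-path : ∀ {v d p} → Geodesic v d p → Path
      geodesic-path {v} {d} {p} g = record
        { at = p ; len = suc d ; steps = steps
        ; inj = λ { (s≤s i≤d) (s≤s j≤d) e →
            dist-unique (dist _ i≤d) (subst (Dist _) (≡-sym e) (dist _ j≤d)) }
        ; induced = λ { (s≤s i≤d) (s≤s j≤d) e → ind i≤d j≤d e } }
        where
        open Geodesic g
        close : ∀ {i j} → i ≤ d → j ≤ d → E (p i) (p j) → j ≤ suc i
        close {i} {j} i≤d j≤d e = ≮⇒≥ λ i<j → proj₂ (dist j j≤d) (suc i) i<j
          (dist-K (dist j j≤d) , p i , proj₁ (dist i i≤d) , e)
        ind : ∀ {i j} → i ≤ d → j ≤ d → E (p i) (p j) → j ≡ suc i ⊎ i ≡ suc j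
        ind {i} {j} i≤d j≤d e with <-cmp i j
        ... | tri< i<j _ _ = inj₁ (≤-antisym (close i≤d j≤d e) i<j)
        ... | tri≈ _ refl _ = ⊥-elim (E-irrefl e)
        ... | tri> _ _ j<i = inj₂ (≤-antisym (close j≤d i≤d (E-sym e)) j<i)

    ball : ℕ → List V
    ball zero = r ∷ []
    ball (suc k) = ball k ++ concatMap nbrs (ball k)

    walk-ball : ∀ d k → d ≤ k → ∀ {v} → Walk d v → v ∈ ball k
    walk-ball zero zero _ refl = here refl
    walk-ball d (suc k) d≤ w with m≤n⇒m<n∨m≡n d≤
    ... | inj₁ (s≤s d≤k) = ∈-++⁺ˡ (walk-ball d k d≤k w)
    walk-ball .(suc k) (suc k) _ (_ , u , w , e) | inj₂ refl =
      ∈-++⁺ʳ (ball k) (∈-concatMap⁺ nbrs (lose (walk-ball k k ≤-refl w) (∈-nbrs e)))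

    ball-length : ∀ D → (∀ v → deg G v ≤ D) → ∀ k → length (ball k) ≤ suc D ^ k
    ball-length D le zero = ≤-refl
    ball-length D le (suc k) = ≤-trans (≤-reflexive (length-++ (ball k)))
      (≤-trans (+-monoʳ-≤ (length (ball k)) (sphere (ball k))) (*-monoʳ-≤ (suc D) (ball-length D le k)))
      where
      sphere : ∀ xs → length (concatMap nbrs xs) ≤ D * length xs
      sphere [] = z≤n
      sphere (x ∷ xs) = ≤-trans (≤-reflexive (length-++ (nbrs x)))
        (≤-trans (+-mono-≤ (≤-trans (≤-reflexive (≡-sym (deg-nbrs x))) (le x)) (sphere xs))
          (≤-reflexive (≡-sym (*-suc D (length xs)))))

    far-vertex : ∀ D m → (∀ v → deg G v ≤ D) → (∀ v → Reach G K r v) → suc D ^ m < n →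
      (∀ v d → m < d → Dist d v → ⊥) → ⊥
    far-vertex D m le conn big κ =
      finChoice (λ v → v ∈ ball m) near λ near →
      <⇒≱ big (≤-trans (≤-reflexive (≡-sym (length-tabulate {n = n} id)))
        (≤-trans (unique-length (ball m) (Uniqueₚ.allFin⁺ n) (λ {v} _ → near v)) (ball-length D le m)))
      where
      near : ∀ v → ¬ ¬ (v ∈ ball m)
      near v ∉ball = reach-dist (conn v) λ { (d , D) →
        ∉ball (walk-ball d m (≮⇒≥ (λ m<d → κ v d m<d D)) (proj₁ D)) }

  -- Leaves of a union of geodesics from r are rungs between the union and Q; so few of them
  -- are pairwise off each other's geodesics, and a single geodesic picks up many terminals.
  many-terminals-on-geodesic : ∀ {ℓ} → 1 ≤ ℓ → ¬ HasMinor (K2 ℓ) G →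
    (K Q : V → Set) → Conn K → Conn Q → Disj Q K → ∀ M (xs : List V) → Unique xs →
    (∀ {x} → x ∈ xs → K x × ∃ λ q → Q q × E x q) → suc (ℓ * suc M) ≤ length xs →
    (∀ (P : Path) → let open Path P in (∀ k → k < len → K (at k)) →
       ∀ ks → AllPairs _<_ ks → M ≤ length ks →
       (∀ {k} → k ∈ ks → k < len × Bridges.Terminal P Q k) → ⊥) → ⊥
  many-terminals-on-geodesic {ℓ} 1≤ℓ noK K Q cK cQ dQK M xs@(r ∷ _) uniq KQ big κ =
    decAll (λ v → ∃ λ q → Q q × E v q) λ T? →
    finChoice Geo geo λ geos →
    -- The root is set aside, as its geodesic has no vertex before the end; the outer `suc` in the
    -- hypothesis pays for it.
    prune (_≡ r) 1 (ℓ * suc M) xs big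
      (λ ys s a → unique-length (r ∷ []) (AllPairs-resp-⊆ s uniq) (λ y∈ → here (All.lookup a y∈))) λ zs s ≢r big′ →
    main T? geos zs s ≢r big′
    where
    open From K r
    Kr : K r
    Kr = proj₁ (KQ (here refl))
    Geo : V → Set
    Geo v = ∃ λ d → ∃ λ p → K v → Geodesic v d p
    geo : ∀ v → ¬ ¬ Geo v
    geo v κ = lem (K v) λ
      { (no ¬K) → κ (0 , (λ _ → r) , λ Kv → ⊥-elim (¬K Kv))
      ; (yes Kv) → reach-dist (cK r v Kr Kv) λ { (d , D) → let (p , g) = geodesic d D in κ (d , p , λ _ → g) } }
    module _ (T? : ∀ v → Dec (∃ λ q → Q q × E v q)) (geos : ∀ v → Geo v)
             (zs : List V) (s : zs ⊆ xs) (≢r : All (_≢ r) zs) (big′ : ℓ * suc M ≤ length zs) where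
      δ : V → ℕ
      δ v = proj₁ (geos v)
      g : V → ℕ → V
      g v = proj₁ (proj₂ (geos v))
      OnG : V → V → Set
      OnG x = Seg (g x) 0 (suc (δ x))
      module Of {x} (x∈ : x ∈ zs) where
        Kx : K x
        Kx = proj₁ (KQ (⊆-∈ s x∈))
        open Geodesic (proj₂ (proj₂ (geos x)) Kx) public
        path : Path
        path = geodesic-path Kr (proj₂ (proj₂ (geos x)) Kx)
        in-K : ∀ k → k ≤ δ x → K (g x k)
        in-K k k≤ = dist-K Kr (dist k k≤)
      δ-at : ∀ {x y k} → (x∈ : x ∈ zs) → (y∈ : y ∈ zs) → k ≤ δ x → y ≡ g x k → δ y ≡ k
      δ-at {x} {y} {k} x∈ y∈ k≤ e = dist-unique
        (subst (Dist (δ y)) (Of.end y∈) (Of.dist y∈ _ ≤-refl))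
        (subst (Dist k) (≡-sym e) (Of.dist x∈ k k≤))
      few : ∀ {x} → x ∈ zs → ∀ ys → ys ⊆ zs → All (λ y → δ y ≤ δ x × OnG x y) ys → length ys ≤ M
      -- Every entry has a neighbour in `Q`, so more than `M` entries on one geodesic are terminals
      -- of it, enough for `κ`.
      few {x} x∈ ys t a = ≮⇒≥ λ M<ys →
        κ (Of.path x∈) (λ { k (s≤s k≤) → Of.in-K x∈ k k≤ }) ks
          (AllPairsₚ.filter⁺ (λ k → T? (g x k)) (AllPairsₚ.applyUpTo⁺₁ id (suc (δ x)) (λ i<j _ → i<j)))
          (≤-trans (<⇒≤ M<ys) enough)
          (λ k∈ → let (k∈′ , t) = ∈-filter⁻ (λ k → T? (g x k)) {xs = upTo (suc (δ x))} k∈ in ∈-upTo⁻ k∈′ , t)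
        where
        ks : List ℕ
        ks = filter (λ k → T? (g x k)) (upTo (suc (δ x)))
        hit : ∀ {y} → y ∈ ys → y ∈ map (g x) ks
        hit y∈ with All.lookup a y∈
        ... | _ , k , _ , k< , refl =
          ∈-map⁺ (g x) (∈-filter⁺ (λ k → T? (g x k)) (∈-upTo⁺ k<) (proj₂ (KQ (⊆-∈ (⊆-trans t s) y∈))))
        enough : length ys ≤ length ks
        enough = ≤-trans (unique-length (map (g x) ks) (AllPairs-resp-⊆ (⊆-trans t s) uniq) hit)
          (≤-reflexive (length-map (g x) ks))
      main : ⊥
      -- Far vertices are chosen first, so later ones avoid the geodesics of earlier ones.
      -- Conversely, an earlier `x` on the geodesic of a later `y` is no farther than `y`, hence
      -- equally far, hence the end `y` itself.
      main = greedy δ OnG M ℓ zs few big′ λ ys e ys∈ ap → leaves ys e (All.lookup ys∈)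
        (AllPairs-map-∈ ys (λ {x} {y} x∈ y∈ (δ≤ , off) → off , λ { (k , _ , s≤s k≤ , x≡) →
            let δx≡k = δ-at (All.lookup ys∈ y∈) (All.lookup ys∈ x∈) k≤ x≡
                k≡δy = ≤-antisym k≤ (≤-trans δ≤ (≤-reflexive δx≡k))
                x≡y = trans x≡ (trans (cong (g y) k≡δy) (Of.end (All.lookup ys∈ y∈)))
            in off (subst (OnG x) x≡y (δ x , z≤n , ≤-refl , ≡-sym (Of.end (All.lookup ys∈ x∈)))) }) ap)
        where
        Off : V → V → Set
        Off x y = ¬ OnG x y × ¬ OnG y x
        leaves : ∀ ys → length ys ≡ ℓ → (∀ {y} → y ∈ ys → y ∈ zs) → AllPairs Off ys → ⊥
        leaves ys e ys∈ ap = <-irrefl e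
          (K2-minor 1≤ℓ noK A Q (λ x v → v ≡ x) ys cA cQ
            (λ { v ((x , x∈ , k , _ , s≤s k≤ , refl) , _) q → dQK v q (Of.in-K (ys∈ x∈) k k≤) })
            rungs
            (AllPairs-map-∈ ys (λ { {x} {y} x∈ y∈ (off , _) v refl refl →
              off (δ x , z≤n , ≤-refl , ≡-sym (Of.end (ys∈ x∈))) }) ap))
          where
          -- The union of the geodesics without its leaves: it is connected through `r`, and each
          -- leaf touches it at the vertex before the end of its geodesic.
          A : V → Set
          A v = (∃ λ x → x ∈ ys × OnG x v) × v ∉ ys
          leaf-end : ∀ {x k} → x ∈ ys → k ≤ δ x → g x k ∈ ys → k ≡ δ x
          leaf-end {x} {k} x∈ k≤ gk∈ with AllPairs⇒≡∨ ys (λ (a , b) → b , a) ap x∈ gk∈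
          ... | inj₁ eq = ≡-sym (δ-at (ys∈ x∈) (ys∈ x∈) k≤ eq)
          ... | inj₂ (off , _) = ⊥-elim (off (k , z≤n , s≤s k≤ , refl))
          below : ∀ {x k} → x ∈ ys → k < δ x → A (g x k)
          below {x} {k} x∈ k< = (x , x∈ , k , z≤n , m<n⇒m<1+n k< , refl) , λ gk∈ → <-irrefl (leaf-end x∈ (<⇒≤ k<) gk∈) k<
          root : ∀ {x} → (x∈ : x ∈ ys) → g x 0 ≡ r
          root x∈ = proj₁ (Of.dist (ys∈ x∈) 0 z≤n)
          cA : Conn A
          cA = conn-via r λ { ((x , x∈ , k , _ , s≤s k≤ , refl) , ∉ys) →
            subst (λ u → Reach G A u (g x k)) (root x∈)
              (walk (Of.steps (ys∈ x∈)) 0 k z≤n (s≤s k≤) λ j _ j≤k →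
                below x∈ (≤-<-trans j≤k (≤∧≢⇒< k≤ λ { refl →
                  ∉ys (subst (_∈ ys) (≡-sym (Of.end (ys∈ x∈))) x∈) }))) }
          rungs : ∀ {x} → x ∈ ys → Rung A Q (_≡ x)
          rungs {x} x∈ = record
            { R-conn = λ { u v refl refl → here refl }
            ; R-A = toA (δ x) refl
            ; R-B = let (_ , q , Qq , e) = KQ (⊆-∈ s (ys∈ x∈)) in x , q , refl , Qq , e
            ; A-disj = λ { v (_ , ∉ys) refl → ∉ys x∈ }
            ; B-disj = λ { v q refl → dQK v q (Of.Kx (ys∈ x∈)) } }
            where
            toA : ∀ d → δ x ≡ d → Sees (_≡ x) A
            toA zero δ≡ = ⊥-elim (All.lookup ≢r (ys∈ x∈)
              (trans (≡-sym (Of.end (ys∈ x∈))) (trans (cong (g x) δ≡) (root x∈))))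
            toA (suc d) δ≡ = x , g x d , refl , below x∈ (≤-reflexive (≡-sym δ≡)) ,
              subst (λ v → E v (g x d)) (trans (cong (g x) (≡-sym δ≡)) (Of.end (ys∈ x∈)))
                (E-sym (Of.steps (ys∈ x∈) d (s≤s (≤-reflexive (≡-sym δ≡)))))

-- Segments of increasing lists, and clean windows of an induced path.

advance : ∀ w (a : ℕ) ks → AllPairs _<_ (a ∷ ks) → suc w ≤ length (a ∷ ks) →
  ∃ λ b → ∃ λ rest → b ∈ a ∷ ks × a + w ≤ b × rest ⊆ ks × All (b <_) rest ×
    length (a ∷ ks) ≡ suc w + length rest
advance zero a ks (lt ∷ _) _ = a , ks , here refl , ≤-reflexive (+-identityʳ a) , ⊆-refl , lt , refl
advance (suc w) a (a′ ∷ ks) ((a<a′ ∷ _) ∷ ap) (s≤s le) with advance w a′ ks ap le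
... | b , rest , b∈ , le′ , s , lt , e =
  b , rest , there b∈ , ≤-trans (≤-reflexive (+-suc a w)) (≤-trans (+-monoˡ-≤ w a<a′) le′) ,
  a′ ∷ʳ s , lt , cong suc e

Wide : ℕ → List ℕ → ℕ × ℕ → Set
Wide w ks (a , b) = a ∈ ks × b ∈ ks × a + w ≤ b

-- Runs of `suc w` entries are wide enough, because `w` steps in a strictly increasing list raise
-- the value by at least `w`.
segments : ∀ w m ks → AllPairs _<_ ks → m * suc w ≤ length ks →
  ∃ λ ss → length ss ≡ m × All (Wide w ks) ss × AllPairs (λ s t → proj₂ s < proj₁ t) ss
segments w zero ks ap le = [] , refl , [] , []
segments w (suc m) (a ∷ ks) ap@(_ ∷ ap′) le with advance w a ks ap (≤-trans (m≤m+n (suc w) (m * suc w)) le)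
... | b , rest , b∈ , a+w≤b , s , lt , e
  with segments w m rest (AllPairs-resp-⊆ s ap′)
         (+-cancelˡ-≤ (suc w) _ _ (≤-trans le (≤-reflexive e)))
... | ss , e′ , wide , ap″ =
  (a , b) ∷ ss , cong suc e′ ,
  (here refl , b∈ , a+w≤b) ∷ All.map (λ (x∈ , y∈ , le) → there (⊆-∈ s x∈) , there (⊆-∈ s y∈) , le) wide ,
  All.map (λ (x∈ , _) → All.lookup lt x∈) wide ∷ ap″

-- At most `ℓ` bridges to `Q` and `ℓ * suc ℓ` gains represent all troublesome bridges, and each is
-- attached to at most `ℓ` segments; one more segment remains unseen.
window-bound : ℕ → ℕ
window-bound ℓ = (ℓ + ℓ * suc ℓ) * ℓ + 1

module Windows {n : ℕ} (G : Graph n) (k3 : KConnected 3 G) {ℓ : ℕ} (1≤ℓ : 1 ≤ ℓ) (noK : ¬ HasMinor (K2 ℓ) G) where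
  open Basics G
  open Paths G

  module _ (P : Path) (Q : V → Set) (cQ : Conn Q) (off : ∀ k → k < Path.len P → ¬ Q (Path.at P k)) where
    open Path P
    open Bridges P Q

    Comp : V → V → Set
    Comp = Reach G Rest

    comp-Rest : ∀ {c v} → Comp c v → Rest v
    comp-Rest = R-right

    comps-disj : ∀ {c c′} → ¬ Comp c c′ → Disj (Comp c) (Comp c′)
    comps-disj ¬r v r r′ = ¬r (R-trans r (R-sym r′))

    On-conn : Conn On
    On-conn = seg-conn steps 0 len ≤-refl

    record BridgeToQ : Set where
      field
        root : V
        rest : Rest root
        toQ : AttachQ root
        pos : ℕ
        pos< : pos < len
        toP : Attach root pos

    -- A bridge bypassing a terminal: leading `P` through it sets free a piece of `P` that still
    -- touches `Q`.
    record Gain : Set where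
      field
        root : V
        rest : Rest root
        lo mid hi : ℕ
        lo<mid : lo < mid
        mid<hi : mid < hi
        hi<len : hi < len
        at-lo : Attach root lo
        at-hi : Attach root hi
        term : Terminal mid
      lo<hi : lo < hi
      lo<hi = <-trans lo<mid mid<hi
      lo<len : lo < len
      lo<len = <-trans lo<hi hi<len

    comp-attach : ∀ {c k} → Attach c k → ∃ λ e → Comp c e × E (at k) e
    comp-attach (e , r , a) = e , r , E-sym a

    -- `P` and `Q` are the rails, and the bridges are the rungs.
    few-bridges-to-Q : ∀ (bs : List BridgeToQ) → length bs ≡ ℓ →
      AllPairs (λ x y → ¬ Comp (BridgeToQ.root x) (BridgeToQ.root y)) bs → ⊥
    few-bridges-to-Q bs e ap = <-irrefl e
      (K2-minor 1≤ℓ noK On Q (λ b → Comp (BridgeToQ.root b)) bs On-conn cQ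
        (λ { v (k , _ , k< , refl) q → off k k< q })
        (λ {b} _ → record
          { R-conn = comp-conn
          ; R-A = let (w , r , a) = BridgeToQ.toP b in
              w , at (BridgeToQ.pos b) , r , (BridgeToQ.pos b , z≤n , BridgeToQ.pos< b , refl) , a
          ; R-B = let (w , q , r , Qq , a) = BridgeToQ.toQ b in w , q , r , Qq , a
          ; A-disj = λ v on r → proj₂ (comp-Rest r) on
          ; B-disj = λ v q r → proj₁ (comp-Rest r) q })
        (AllPairs.map comps-disj ap))

    -- The gains with pairwise disjoint spans are used simultaneously: P is rerouted through
    -- their bridges, and the freed parts of P are rungs between the rerouted path and Q.
    few-gains : ∀ (gs : List Gain) → length gs ≡ ℓ * suc ℓ →
      AllPairs (λ x y → ¬ Comp (Gain.root x) (Gain.root y)) gs → ⊥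
    few-gains gs e ap = greedy lo (λ g h → lo g < hi h) ℓ ℓ gs crossing (≤-reflexive (≡-sym e)) reroute
      where
      open Gain
      -- These spans all cover the edge of `P` after position `lo g`. The two parts of `P` on either
      -- side of it are rails with the bridges as rungs.
      crossing : ∀ {g} → g ∈ gs → ∀ hs → hs ⊆ gs → All (λ h → lo h ≤ lo g × lo g < hi h) hs → length hs ≤ ℓ
      crossing {g} _ hs s a = <⇒≤
        (K2-minor 1≤ℓ noK (Seg at 0 (suc (lo g))) (Seg at (suc (lo g)) len) (λ h → Comp (root h)) hs
          (seg-conn steps 0 _ (lo<len g)) (seg-conn steps _ len ≤-refl)
          (λ { v (i , _ , i< , refl) (j , <j , j< , e) →
            <⇒≱ <j (≤-trans (≤-reflexive (≡-sym (inj (<-≤-trans i< (lo<len g)) j< e))) (≤-pred i<)) })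
          (λ {h} h∈ → let (lo≤ , <hi) = All.lookup a h∈ in record
            { R-conn = comp-conn
            ; R-A = let (w , r , a) = at-lo h in w , at (lo h) , r , (lo h , z≤n , s≤s lo≤ , refl) , a
            ; R-B = let (w , r , a) = at-hi h in w , at (hi h) , r , (hi h , <hi , hi<len h , refl) , a
            ; A-disj = λ { v (k , _ , k< , e) r → proj₂ (comp-Rest r) (k , z≤n , <-≤-trans k< (lo<len g) , e) }
            ; B-disj = λ { v (k , _ , k< , e) r → proj₂ (comp-Rest r) (k , z≤n , k< , e) } })
          (AllPairs.map comps-disj (AllPairs-resp-⊆ s ap)))
      reroute : ∀ hs → length hs ≡ ℓ → All (_∈ gs) hs →
        AllPairs (λ g h → lo h ≤ lo g × ¬ (lo g < hi h)) hs → ⊥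
      reroute hs e′ hs∈ ap′ = <-irrefl e′
        (K2-minor 1≤ℓ noK Rail Q (λ g → Seg at (suc (lo g)) (hi g)) hs
          (rail-conn (λ {g} _ → lo<hi g) apart steps (λ {g} _ → hi<len g) (λ _ → comp-conn)
            (λ {g} _ → comp-attach (at-lo g)) (λ {g} _ → comp-attach (at-hi g)))
          cQ
          (λ { v (inj₁ (k , k< , _ , refl)) q → off k k< q
             ; v (inj₂ (g , _ , r)) q → proj₁ (comp-Rest r) q })
          (λ {g} g∈ → record
            { R-conn = seg-conn steps _ _ (<⇒≤ (hi<len g))
            ; R-A = at (suc (lo g)) , at (lo g) ,
                (suc (lo g) , ≤-refl , ≤-<-trans (lo<mid g) (mid<hi g) , refl) ,
                inj₁ (lo g , lo<len g , lo-outside (λ {g} _ → lo<hi g) apart g∈ , refl) ,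
                E-sym (steps (lo g) (≤-<-trans (lo<hi g) (hi<len g)))
            ; R-B = let (q , Qq , a) = term g in
                at (mid g) , q , (mid g , lo<mid g , mid<hi g , refl) , Qq , a
            ; A-disj = λ
                { v (inj₁ (k , k< , out , refl)) (j , <j , j< , e) →
                    let k≡j = inj k< (<-trans j< (hi<len g)) e in
                    out g∈ (<-≤-trans <j (≤-reflexive (≡-sym k≡j))) (≤-<-trans (≤-reflexive k≡j) j<)
                ; v (inj₂ (h , _ , r)) (j , _ , j< , e) →
                    proj₂ (comp-Rest r) (j , z≤n , <-trans j< (hi<len g) , e) }
            ; B-disj = λ { v q (j , _ , j< , refl) → off j (<-trans j< (hi<len g)) q } })
          (AllPairs-map-∈ hs (λ { {g} {h} _ _ hi≤ v (i , <i , i< , refl) (j , <j , j< , e) →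
              let i≡j = inj (<-trans i< (hi<len g)) (<-trans j< (hi<len h)) e in
              <⇒≱ (<-trans <i (≤-<-trans (≤-reflexive i≡j) j<)) (≮⇒≥ (proj₂ hi≤)) }) ap′))
        where
        D-of : Gain → V → Set
        D-of g = Comp (root g)
        open Reroute at len lo hi hs D-of
        apart : AllPairs Apart hs
        apart = AllPairs.map (λ (_ , ¬lt) → inj₂ (≮⇒≥ ¬lt)) ap′

    SeenBy : V → ℕ × ℕ → Set
    SeenBy c (a , b) = ∃ λ k → a ≤ k × k ≤ b × Attach c k

    Good : ℕ × ℕ → Set
    Good (a , b) = a ≤ b × b < len × Terminal a

    -- Now one bridge and `Q` are the rails and the segments are the rungs: the bridge attaches to
    -- each of them, and each starts at a terminal.
    few-segments-seen : ∀ {c} → Rest c → (ss : List (ℕ × ℕ)) → All Good ss →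
      AllPairs (λ s t → proj₂ s < proj₁ t) ss → All (SeenBy c) ss → length ss ≤ ℓ
    few-segments-seen {c} Rc ss good ap seen = <⇒≤
      (K2-minor 1≤ℓ noK (Comp c) Q (λ (a , b) → Seg at a (suc b)) ss comp-conn cQ
        (λ v r q → proj₁ (comp-Rest r) q)
        (λ {(a , b)} s∈ →
          let (a≤b , b< , (q , Qq , eq)) = All.lookup good s∈
              (k , a≤k , k≤b , (w , r , e)) = All.lookup seen s∈ in record
          { R-conn = seg-conn steps a (suc b) b<
          ; R-A = at k , w , (k , a≤k , s≤s k≤b , refl) , r , E-sym e
          ; R-B = at a , q , (a , ≤-refl , s≤s a≤b , refl) , Qq , eq
          ; A-disj = λ { v r (j , _ , s≤s j≤ , refl) → proj₂ (comp-Rest r) (j , z≤n , ≤-<-trans j≤ b< , refl) }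
          ; B-disj = λ { v q (j , _ , s≤s j≤ , refl) → off j (≤-<-trans j≤ b<) q } })
        (AllPairs-map-∈ ss (λ { s∈ t∈ b<a′ v (i , _ , s≤s i≤ , refl) (j , ≤j , s≤s j≤ , e) →
          let (_ , b< , _) = All.lookup good s∈
              (_ , b′< , _) = All.lookup good t∈
              i≡j = inj (≤-<-trans i≤ b<) (≤-<-trans j≤ b′<) e in
          <⇒≱ (<-≤-trans b<a′ ≤j) (≤-trans (≤-reflexive (≡-sym i≡j)) i≤) }) ap))

    unseen-segment : ∀ (cs : List V) (ss : List (ℕ × ℕ)) → All Rest cs → All Good ss →
      AllPairs (λ s t → proj₂ s < proj₁ t) ss → length cs * ℓ + 1 ≤ length ss →
      (∀ s → s ∈ ss → (∀ {c} → c ∈ cs → ¬ SeenBy c s) → ⊥) → ⊥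
    unseen-segment [] (s ∷ ss) _ _ _ _ κ = κ s (here refl) (λ ())
    unseen-segment (c ∷ cs) ss (Rc ∷ Rcs) good ap le κ =
      prune (SeenBy c) ℓ (length cs * ℓ + 1) ss (≤-trans (≤-reflexive (≡-sym (+-assoc ℓ _ 1))) le)
        (λ ys s a → few-segments-seen Rc ys (All-resp-⊆ s good) (AllPairs-resp-⊆ s ap) a) λ zs s ¬seen le′ →
      unseen-segment cs zs Rcs (All-resp-⊆ s good) (AllPairs-resp-⊆ s ap) le′ λ t t∈ f →
      κ t (⊆-∈ s t∈) λ { (here refl) → All.lookup ¬seen t∈ ; (there c∈) → f c∈ }

    -- A violation would be a `BridgeToQ` or a `Gain` attached between `a` and `b`.
    Fresh : ℕ → ℕ → Set
    Fresh a b = ∀ {k v} → a ≤ k → k ≤ b → Rest v → Attach v k → ¬ AttachQ v ×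
      (∀ {x z y} → x < z → z < y → y < len → Attach v x → Attach v y → ¬ Terminal z)

    module _ {a b : ℕ} (b< : b < len) (Ta : Terminal a) (Tb : Terminal b) (fresh : Fresh a b) where

      pocket : ∀ x y → x ≤ y → y < len → (∀ k → x < k → k < y → ¬ Terminal k) →
        (∀ k → x < k → k < y → ∀ v → Rest v → Attach v k → Enclosed x y v) →
        ∀ v → ¬ (Seg at (suc x) y v ⊎ Enclosed x y v)
      pocket = no-pocket k3 off (proj₁ Ta , proj₁ (proj₂ Ta))

      -- Take the terminals `x` and `y` nearest to a nonterminal `k` on both sides. A bridge
      -- attached strictly between them cannot attach beyond either, as it would bypass a terminal;
      -- so `x` and `y` bound a pocket.
      all-terminal : ∀ k → a ≤ k → k ≤ b → ¬ ¬ Terminal k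
      all-terminal k a≤k k≤b ¬Tk =
        lastBefore Terminal a Ta k a≤k λ x a≤x x≤k Tx none →
        firstAfter Terminal b Tb (b ∸ k) k (m+[n∸m]≡n k≤b) λ y k≤y y≤b Ty none′ →
        let x<k = ≤∧≢⇒< x≤k (λ { refl → ¬Tk Tx })
            k<y = ≤∧≢⇒< k≤y (λ { refl → ¬Tk Ty })
            y< = ≤-<-trans y≤b b< in
        pocket x y (≤-trans x≤k k≤y) y<
          (λ m x<m m<y → [ none m x<m , (λ k≤m → none′ m k≤m m<y) ]′ (≤-total m k))
          (λ m x<m m<y v Rv at-m →
            let (¬toQ , ¬gain) = fresh (≤-trans a≤x (<⇒≤ x<m)) (≤-trans (<⇒≤ m<y) y≤b) Rv at-m in
            Rv ,
            (λ i i< at-i → ≮⇒≥ (λ i<x → ¬gain i<x x<m (<-trans m<y y<) at-i at-m Tx) ,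
                           ≮⇒≥ (λ y<i → ¬gain m<y y<i i< at-m at-i Ty)) ,
            ¬toQ)
          (at k) (inj₁ (k , x<k , k<y , refl))

      -- All positions nearby being terminals, a bridge cannot attach on both sides of one. So its
      -- attachments lie in two consecutive positions, which bound a pocket.
      no-rest-nbr : ∀ k → a < k → k < b → ∀ v → E (at k) v → ¬ Rest v
      no-rest-nbr (suc k) (s≤s a≤k) k<b v e Rv with fresh (m≤n⇒m≤1+n a≤k) (<⇒≤ k<b) Rv at-k
        where
        at-k : Attach v (suc k)
        at-k = v , here Rv , E-sym e
      ... | ¬toQ , ¬gain = lem (Attach v (2 + k)) λ
        { (yes at-2+k) → pocket (suc k) (2 + k) (n≤1+n _) (≤-<-trans k<b b<)
            (λ m lt gt → ⊥-elim (<⇒≱ lt (≤-pred gt)))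
            (λ m lt gt → ⊥-elim (<⇒≱ lt (≤-pred gt))) v
            (inj₂ (Rv , (λ i i< at-i →
              ≮⇒≥ (λ i<k → T (suc k) (m≤n⇒m≤1+n a≤k) (<⇒≤ k<b) λ t → ¬gain i<k (n<1+n _) (≤-<-trans k<b b<) at-i at-2+k t) ,
              ≮⇒≥ (λ lt → T (2 + k) (≤-trans a≤k (≤-trans (n≤1+n _) (n≤1+n _))) k<b λ t → ¬gain (n<1+n _) lt i< at-k at-i t)) , ¬toQ))
        -- Without an attachment at `2 + k` the two positions are `k` and `suc k`: any attachment
        -- further right would lie beyond `2 + k` and bypass it.
        ; (no ¬at-2+k) → pocket k (suc k) (n≤1+n _) (<-trans k<b b<)
            (λ m lt gt → ⊥-elim (<⇒≱ lt (≤-pred gt)))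
            (λ m lt gt → ⊥-elim (<⇒≱ lt (≤-pred gt))) v
            (inj₂ (Rv , (λ i i< at-i →
              ≮⇒≥ (λ i<k → T k a≤k (≤-trans (n≤1+n _) (<⇒≤ k<b)) λ t → ¬gain i<k (n<1+n _) (<-trans k<b b<) at-i at-k t) ,
              ≮⇒≥ (λ lt → T (2 + k) (≤-trans a≤k (≤-trans (n≤1+n _) (n≤1+n _))) k<b λ t →
                ¬gain (n<1+n _) (≤∧≢⇒< lt (λ e → ¬at-2+k (subst (Attach v) (≡-sym e) at-i))) i< at-k at-i t)) , ¬toQ)) }
        where
        at-k : Attach v (suc k)
        at-k = v , here Rv , E-sym e
        T : ∀ k → a ≤ k → k ≤ b → ¬ ¬ Terminal k
        T = all-terminal

    -- Some segment between terminals is attached to none of the representatives of bridges to `Q`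
    -- and of gains. An offending bridge attached to it would be the same component as a
    -- representative, which would then be attached there too; so the segment is fresh.
    clean-window : ∀ w ks → AllPairs _<_ ks → (∀ {k} → k ∈ ks → k < len × Terminal k) →
      window-bound ℓ * suc w ≤ length ks →
      (∀ x → x + w < len →
        (∀ k → x < k → k < x + w → ∀ v → E (at k) v → Q v ⊎ PathNbr P k v) → ⊥) → ⊥
    clean-window w ks ap ks-term big κ =
      decAll Q λ Q? → decAll On λ On? →
      exhaust (λ x y → Comp (BridgeToQ.root x) (BridgeToQ.root y)) ℓ few-bridges-to-Q λ bs bs≤ bs-all →
      exhaust (λ x y → Comp (Gain.root x) (Gain.root y)) (ℓ * suc ℓ) few-gains λ gs gs≤ gs-all →
      let cs = map BridgeToQ.root bs ++ map Gain.root gs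
          (ss , ss-len , wide , ss-ap) = segments w (window-bound ℓ) ks ap big
          cs≤ = ≤-trans (≤-reflexive (trans (length-++ (map BridgeToQ.root bs))
                  (cong₂ _+_ (length-map BridgeToQ.root bs) (length-map Gain.root gs)))) (+-mono-≤ bs≤ gs≤) in
      unseen-segment cs ss (cs-Rest bs gs)
        (All.map (λ (a∈ , b∈ , le) → ≤-trans (m≤m+n _ w) le , proj₁ (ks-term b∈) , proj₂ (ks-term a∈)) wide) ss-ap
        (≤-trans (+-monoˡ-≤ 1 (*-monoˡ-≤ ℓ cs≤)) (≤-reflexive (≡-sym ss-len))) λ { (a , b) s∈ unseen →
      let (a∈ , b∈ , a+w≤b) = All.lookup wide s∈
          b< = proj₁ (ks-term b∈)
          fresh : Fresh a b
          fresh = λ {k} {v} a≤k k≤b Rv at-k →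
            (λ toQ → bs-all (record { rest = Rv ; toQ = toQ ; pos< = ≤-<-trans k≤b b< ; toP = at-k })
              λ { (x , x∈ , r) → unseen (∈-++⁺ˡ (∈-map⁺ BridgeToQ.root x∈)) (k , a≤k , k≤b , along r at-k) }) ,
            (λ x<z z<y y< at-x at-y t →
              gs-all (record { rest = Rv ; lo<mid = x<z ; mid<hi = z<y ; hi<len = y<
                             ; at-lo = at-x ; at-hi = at-y ; term = t })
              λ { (x , x∈ , r) → unseen (∈-++⁺ʳ (map BridgeToQ.root bs) (∈-map⁺ Gain.root x∈))
                                   (k , a≤k , k≤b , along r at-k) }) in
      κ a (≤-<-trans a+w≤b b<) λ k a<k k<a+w v e → nbr b< (Q? v) (On? v) (<-≤-trans k<a+w a+w≤b) e
        (no-rest-nbr b< (proj₂ (ks-term a∈)) (proj₂ (ks-term b∈)) fresh k a<k (<-≤-trans k<a+w a+w≤b) v e) }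
      where
      along : ∀ {c v k} → Comp v c → Attach v k → Attach c k
      along r (w , r′ , e) = w , R-trans (R-sym r) r′ , e
      cs-Rest : ∀ bs gs → All Rest (map BridgeToQ.root bs ++ map Gain.root gs)
      cs-Rest (b ∷ bs) gs = BridgeToQ.rest b ∷ cs-Rest bs gs
      cs-Rest [] (g ∷ gs) = Gain.rest g ∷ cs-Rest [] gs
      cs-Rest [] [] = []
      nbr : ∀ {b k v} → b < len → Dec (Q v) → Dec (On v) → k < b → E (at k) v → ¬ Rest v → Q v ⊎ PathNbr P k v
      nbr b< (yes q) _ _ _ _ = inj₁ q
      nbr b< (no ¬q) (yes (j , _ , j< , refl)) k<b e _ = inj₂ (j , j< , refl , induced (<-trans k<b b<) j< e)
      nbr b< (no ¬q) (no ¬on) _ _ ¬R = ⊥-elim (¬R (¬q , ¬on))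

-- Induced paths with connected complement.

module Nonseparating {n : ℕ} (G : Graph n) (k3 : KConnected 3 G) where
  open Basics G
  open Paths G
  open Geodesics G

  -- Grow a connected set K avoiding a u–v path until K and a geodesic of G − K cover G.
  -- While a bridge of that geodesic is left, K absorbs either a vertex of a bridge, or a path vertex
  -- strictly between two attachments of a bridge; otherwise a 2-separation appears.
  nonseparating-path : ∀ {u v} fuel (ks : List V) → Unique ks → n ≤ length ks + fuel →
    ∃ (_∈ ks) → Conn (_∈ ks) → Reach G (_∉ ks) u v →
    (∀ (P : Path) (K : V → Set) → let open Path P in
       at 0 ≡ u → (∃ λ d → len ≡ suc d × at d ≡ v) → Conn K →
       (∀ k → k < len → ¬ K (at k)) → (∀ w → ¬ Seg at 0 len w → K w) → ⊥) → ⊥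
  -- With the fuel spent, `v` and the entries of `ks` would be more than `n` distinct vertices.
  nonseparating-path {u} {v} zero ks uniq full ne cK r κ = <⇒≱
    (≤-trans (unique-length (allFin n) (All.tabulate (λ x∈ v≡x → R-right r (subst (_∈ ks) (≡-sym v≡x) x∈)) ∷ uniq)
      (λ _ → ∈-allFin _)) (≤-reflexive (length-tabulate {n = n} id)))
    (≤-trans full (≤-reflexive (+-identityʳ _)))
  nonseparating-path {u} {v} (suc fuel) ks uniq full (k₀ , k₀∈) cK r κ =
    reach-dist r λ { (d , D) → let (p , g) = geodesic d D in found d p g }
    where
    open From (_∉ ks) u
    grow : ∀ x → x ∉ ks → (∃ λ k → k ∈ ks × E k x) → Reach G (_∉ x ∷ ks) u v → ⊥
    grow x x∉ (k , k∈ , e) r′ = nonseparating-path fuel (x ∷ ks)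
      (All.tabulate (λ y∈ x≡y → x∉ (subst (_∈ ks) (≡-sym x≡y) y∈)) ∷ uniq)
      (≤-trans full (≤-reflexive (+-suc _ _))) (x , here refl)
      (conn-via k λ
        { (here refl) → R-snoc (here (there k∈)) e (here refl)
        ; (there y∈) → R-map there (cK k _ k∈ y∈) })
      r′ κ
    found : ∀ d p → Geodesic v d p → ⊥
    found d p g = lem (∃ Rest) λ
      { (no covered) → κ P Q start (d , refl , Geodesic.end g) cK off (λ w ¬On → cover covered w ¬On)
      ; (yes (w , Rw)) → lem (∃ λ x → ∃ λ k → Rest x × k ∈ ks × E x k) λ
          -- A bridge vertex next to `K` is absorbed; the geodesic itself still joins `u` to `v`.
          { (yes (x , k , (x∉ , ¬On) , k∈ , e)) → grow x x∉ (k , k∈ , E-sym e)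
              (subst₂ (Reach G _) start (Geodesic.end g)
                (along 0 d z≤n ≤-refl λ j _ j≤d → λ
                  { (here e) → ¬On (j , z≤n , s≤s j≤d , ≡-sym e)
                  ; (there j∈) → off j (s≤s j≤d) j∈ }))
          ; (no ¬RK) → lem (∃ λ z → Inner z × Terminal z) λ
              -- A path vertex next to `K` is absorbed, and the path is led around it through the
              -- bridge.
              { (yes (z , inner , (q , q∈ , e))) → grow (p z) (off z (inner< inner)) (q , q∈ , E-sym e) (detour z inner)
              ; (no ¬IK) → stuck ¬RK ¬IK w Rw } } }
      where
      P : Path
      P = geodesic-path (R-left r) g
      Q : V → Set
      Q = _∈ ks
      open Path P
      open Bridges P Q
      start : p 0 ≡ u
      start = proj₁ (Geodesic.dist g 0 z≤n)
      off : ∀ k → k < suc d → p k ∉ ks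
      off k (s≤s k≤d) = dist-K (R-left r) (Geodesic.dist g k k≤d)
      cover : ¬ ∃ Rest → ∀ w → ¬ On w → w ∈ ks
      cover covered w ¬On with Any.any? (w ≟ᶠ_) ks
      ... | yes w∈ = w∈
      ... | no w∉ = ⊥-elim (covered (w , w∉ , ¬On))
      along : ∀ {A : V → Set} i j → i ≤ j → j ≤ d → (∀ m → i ≤ m → m ≤ j → A (p m)) → Reach G A (p i) (p j)
      along i j i≤j j≤d f = walk steps i j i≤j (s≤s j≤d) f
      Inner : ℕ → Set
      Inner z = ∃ λ c → ∃ λ i → ∃ λ j → Rest c × i < z × z < j × j < len × Attach c i × Attach c j
      inner< : ∀ {z} → Inner z → z < len
      inner< (_ , _ , _ , _ , _ , z<j , j< , _) = <-trans z<j j<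
      detour : ∀ z → Inner z → Reach G (_∉ p z ∷ ks) u v
      detour z inner@(c , i , j , Rc , i<z , z<j , j<@(s≤s j≤d) , (x , rx , ex) , (y , ry , ey)) =
        subst₂ (Reach G _) start (Geodesic.end g)
          (R-trans (R-snoc (along 0 i z≤n (≤-trans (<⇒≤ (<-trans i<z z<j)) j≤d)
                             (λ m _ m≤i → miss m (≤-trans m≤i (<⇒≤ (<-trans i<z z<j))) (<⇒≢ (≤-<-trans m≤i i<z))))
                     (E-sym ex) (rest (R-right rx)))
          (R-trans (R-map rest (R-trans (R-sym rx) ry))
          (step (rest (R-right ry)) ey
            (along j d j≤d ≤-refl (λ m j≤m m≤d → hit m m≤d (λ m≡z → <-irrefl (≡-sym m≡z) (<-≤-trans z<j j≤m)))))))
        where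
        hit : ∀ m → m ≤ d → m ≢ z → p m ∉ p z ∷ ks
        hit m m≤d m≢z (here e) = m≢z (inj (s≤s m≤d) (inner< inner) e)
        hit m m≤d m≢z (there m∈) = off m (s≤s m≤d) m∈
        miss : ∀ m → m ≤ j → m ≢ z → p m ∉ p z ∷ ks
        miss m m≤j = hit m (≤-trans m≤j j≤d)
        rest : ∀ {x} → Rest x → x ∉ p z ∷ ks
        rest (x∉ , ¬On) (here e) = ¬On (z , z≤n , inner< inner , e)
        rest (x∉ , ¬On) (there x∈) = x∉ x∈
      module _ (¬RK : ¬ (∃ λ x → ∃ λ k → Rest x × k ∈ ks × E x k)) (¬IK : ¬ (∃ λ z → Inner z × Terminal z)) where
        ¬AQ : ∀ {c} → ¬ AttachQ c
        ¬AQ (x , q , r , q∈ , e) = ¬RK (x , q , R-right r , q∈ , e)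
        pocket : ∀ x y → x ≤ y → y < len → (∀ k → x < k → k < y → ¬ Terminal k) →
          (∀ k → x < k → k < y → ∀ v → Rest v → Attach v k → Enclosed x y v) →
          ∀ a → ¬ (Seg p (suc x) y a ⊎ Enclosed x y a)
        pocket = no-pocket k3 off (k₀ , k₀∈)
        enclosed : ∀ x y → x ≤ y → y ≤ suc x → y < len → ∀ {w} → Rest w →
          ¬ (∀ k → k < len → Attach w k → x ≤ k × k ≤ y)
        enclosed x y x≤y y≤ y< {w} Rw enc = pocket x y x≤y y<
          (λ k lt gt → ⊥-elim (<⇒≱ gt (≤-trans y≤ lt)))
          (λ k lt gt → ⊥-elim (<⇒≱ gt (≤-trans y≤ lt))) w (inj₂ (Rw , enc , ¬AQ))
        -- Let `x` and `y` be the nearest positions around `z` that are not inner. Between them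
        -- there is no terminal, and a bridge attached there and beyond `x` or `y` would make that
        -- end inner; so they bound a pocket.
        no-inner : ∀ z → ¬ Inner z
        no-inner z inner =
          lastBefore (λ k → ¬ Inner k) 0 (λ { (_ , _ , _ , _ , () , _) }) z z≤n λ x _ x≤z ¬x below →
          firstAfter (λ k → ¬ Inner k) d (λ { (_ , _ , _ , _ , _ , lt , gt , _) → <⇒≱ lt (≤-pred gt) })
            (d ∸ z) z (m+[n∸m]≡n (≤-pred (inner< inner))) λ y z≤y y≤d ¬y above →
          pocket x y (≤-trans x≤z z≤y) (s≤s y≤d)
            (λ k x<k k<y t → [ (λ k≤z → below k x<k k≤z λ i → ¬IK (k , i , t))
                             , (λ z≤k → above k z≤k k<y λ i → ¬IK (k , i , t)) ]′ (≤-total k z))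
            (λ k x<k k<y w Rw at-k → Rw ,
              (λ m m< at-m →
                ≮⇒≥ (λ m<x → ¬x (w , m , k , Rw , m<x , x<k , <-trans k<y (s≤s y≤d) , at-m , at-k)) ,
                ≮⇒≥ (λ y<m → ¬y (w , k , m , Rw , k<y , y<m , m< , at-k , at-m))) ,
              ¬AQ)
            (p z) (inj₁ (z , ≤∧≢⇒< x≤z (λ { refl → ¬x inner }) , ≤∧≢⇒< z≤y (λ { refl → ¬y inner }) , refl))
        -- Without inner positions, a bridge attaches at most at its first attachment `i` and at
        -- `suc i`, which again gives a pocket.
        stuck : ∀ w → ¬ Rest w
        stuck w Rw = lem (∃ λ k → k < len × Attach w k) λ
          { (no none) → enclosed 0 0 z≤n z≤n (s≤s z≤n) Rw (λ k k< a → ⊥-elim (none (k , k< , a)))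
          ; (yes (k , k< , a)) → firstAfter (λ k → k < len × Attach w k) k (k< , a) k 0 refl λ i _ _ (i< , ai) first →
              let least = λ m m< am → ≮⇒≥ (λ m<i → first m z≤n m<i (m< , am))
                  close = λ m m< am → ≮⇒≥ (λ gt → no-inner (suc i) (w , i , m , Rw , n<1+n i , gt , m< , ai , am)) in
              case-end i i< least close }
          where
          case-end : ∀ i → i < len → (∀ m → m < len → Attach w m → i ≤ m) →
            (∀ m → m < len → Attach w m → m ≤ suc i) → ⊥
          case-end i i< least close with suc i <? len
          ... | yes i+1< = enclosed i (suc i) (n≤1+n i) ≤-refl i+1< Rw (λ m m< am → least m m< am , close m m< am)
          -- Here `i` is the last position of the path, and the cut is this one vertex named twice.
          ... | no i+1≮ = enclosed i i ≤-refl (n≤1+n i) i< Rw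
                            (λ m m< am → least m m< am , ≤-pred (≤-trans m< (≮⇒≥ i+1≮)))

-- Two disjoint induced paths: loose pairs, blocks and exchanges.

≡true-ext : ∀ {a b : Bool} → (a ≡ true → b ≡ true) → (b ≡ true → a ≡ true) → a ≡ b
≡true-ext {true} {true} f g = refl
≡true-ext {false} {false} f g = refl
≡true-ext {true} {false} f g = ≡-sym (f refl)
≡true-ext {false} {true} f g = g refl

-- From `ℓ * suc ℓ` blocks `ℓ` remain that are disjoint along both paths, each block uses two
-- windows, and windows are thinned twice, at the cost of a factor `suc ℓ` each time.
rail-bound : ℕ → ℕ
rail-bound ℓ = ((ℓ * suc ℓ) * 2) * suc ℓ * suc ℓ

module TwoRails {n : ℕ} (G : Graph n) (min5 : MinDegAtLeast 5 G) {ℓ : ℕ} (1≤ℓ : 1 ≤ ℓ)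
  (noK : ¬ HasMinor (K2 ℓ) G)
  (noTwins : ∀ u v → Twins G u v → deg G u ≡ 5 → deg G v ≡ 5 → ⊥) (S T : Paths.Path G) where

  open Basics G
  open Paths G
  open Path S using () renaming (at to s; len to M; steps to s-steps; inj to s-inj; induced to s-induced)
  open Path T using () renaming (at to t; len to N; steps to t-steps; inj to t-inj; induced to t-induced)

  OnS OnT : V → Set
  OnS = Seg s 0 M
  OnT = Seg t 0 N

  small-nbhd : ∀ {v} ws → length ws ≤ 4 → (∀ {w} → E v w → w ∈ ws) → ⊥
  small-nbhd {v} ws le cov = <⇒≱ (min5 v) (≤-trans (deg-cover ws cov) le)

  deg≡5 : ∀ {v} ws → length ws ≡ 5 → (∀ {w} → E v w → w ∈ ws) → deg G v ≡ 5
  deg≡5 {v} ws e cov = ≤-antisym (≤-trans (deg-cover ws cov) (≤-reflexive e)) (min5 v)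

  closed⁺ : ∀ {u w} → u ≡ w ⊎ E u w → closedAdj G u w ≡ true
  closed⁺ {u} {w} c with u ≟ᶠ w
  ... | yes _ = refl
  ... | no u≢w = [ (λ u≡w → ⊥-elim (u≢w u≡w)) , id ]′ c

  closed⁻ : ∀ {u w} → closedAdj G u w ≡ true → u ≡ w ⊎ E u w
  closed⁻ {u} {w} c with u ≟ᶠ w
  ... | yes u≡w = inj₁ u≡w
  ... | no _ = inj₂ c

  step-pred : ∀ (P : Path) {k} → 0 < k → k < Path.len P → E (Path.at P (pred k)) (Path.at P k)
  step-pred P {suc k} _ k< = Path.steps P k k<

  Crossing Parallel : (a x b u : ℕ) → Set
  Crossing a x b u = E (s a) (t u) × E (s x) (t b)
  Parallel a x b u = E (s a) (t b) × E (s x) (t u)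

  -- The final alternative provides the skipped vertices that become a rung.
  Loose : (ℕ → ℕ → ℕ → ℕ → Set) → (Lo Hi lo hi : ℕ) → Set
  Loose R Lo Hi lo hi = ∃ λ a → ∃ λ x → ∃ λ b → ∃ λ u →
    Lo ≤ a × a < x × x ≤ Hi × lo ≤ b × b < u × u ≤ hi × R a x b u × (suc a < x ⊎ suc b < u)

  -- In `window`, `t lo` and `t hi` are the extreme neighbours of `s j`, `t c` is a neighbour
  -- between them, and `s Lo` and `s Hi` are the extreme neighbours of `t c`. Thus `s j` can serve
  -- as a rung between two parts of `T`, and `t c` between two parts of `S`.
  record Window : Set where
    field
      j lo c hi Lo Hi : ℕ
      j<M : j < M
      lo<c : lo < c
      c<hi : c < hi
      hi<N : hi < N
      j-lo : E (s j) (t lo)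
      j-hi : E (s j) (t hi)
      Hi<M : Hi < M
      c-Lo : E (t c) (s Lo)
      c-Hi : E (t c) (s Hi)
      crossing : Loose Crossing Lo Hi lo hi
      parallel : Loose Parallel Lo Hi lo hi
    lo<hi : lo < hi
    lo<hi = <-trans lo<c c<hi
    Lo<Hi : Lo < Hi
    Lo<Hi = let (_ , _ , _ , _ , Lo≤a , a<x , x≤Hi , _) = crossing in ≤-<-trans Lo≤a (<-≤-trans a<x x≤Hi)

  module Local (S∩T : Disj OnS OnT) (lb ub : ℕ) (ub<N : ub < N)
    (cleanT : ∀ k → lb < k → k < ub → ∀ v → E (t k) v → OnS v ⊎ PathNbr T k v) where

    CleanS : ℕ → Set
    CleanS j = ∀ v → E (s j) v → (∃ λ k → lb < k × k < ub × v ≡ t k) ⊎ PathNbr S j v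

    module _ {j : ℕ} (j<M : j < M) (clean : CleanS j) where

      NbS : ℕ → Set
      NbS k = k < N × E (s j) (t k)

      -- The lists bound degrees only from above, so an entry `s (pred j)` or `s (suc j)` without
      -- meaning at an end of the path does no harm.
      s-cover : ∀ ws → s (pred j) ∈ ws → s (suc j) ∈ ws → (∀ k → NbS k → t k ∈ ws) →
        ∀ {w} → E (s j) w → w ∈ ws
      s-cover ws p∈ s∈ t∈ {w} e with clean w e
      ... | inj₁ (k , _ , k<ub , refl) = t∈ k (<-trans k<ub ub<N , e)
      ... | inj₂ (_ , _ , refl , inj₁ refl) = s∈
      ... | inj₂ (_ , _ , refl , inj₂ refl) = p∈

      inner : ∀ {k} → NbS k → lb < k × k < ub
      inner {k} (k<N , e) with clean (t k) e
      ... | inj₁ (m , l , u , eq) = subst (λ i → lb < i × i < ub) (t-inj (<-trans u ub<N) k<N (≡-sym eq)) (l , u)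
      ... | inj₂ (m , m<M , eq , _) = ⊥-elim (S∩T _ (m , z≤n , m<M , eq) (k , z≤n , k<N , refl))

      module _ {c : ℕ} (Nc : NbS c) where

        NbT : ℕ → Set
        NbT k = k < M × E (t c) (s k)

        t-cover : ∀ ws → t (pred c) ∈ ws → t (suc c) ∈ ws → (∀ k → NbT k → s k ∈ ws) →
          ∀ {w} → E (t c) w → w ∈ ws
        t-cover ws p∈ s∈ t∈ {w} e with cleanT c (proj₁ (inner Nc)) (proj₂ (inner Nc)) w e
        ... | inj₁ (k , _ , k<M , refl) = t∈ k (k<M , e)
        ... | inj₂ (_ , _ , refl , inj₁ refl) = s∈
        ... | inj₂ (_ , _ , refl , inj₂ refl) = p∈

        -- `H₁` leaves five possible neighbours of `t c`, so by minimum degree all occur, among them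
        -- `s (pred j)` and `s (suc j)`. They supply the premises of `H₂`, and the same count at
        -- `s j` makes the two vertices twins of degree 5.
        twins : (∀ k → NbT k → suc k ≡ j ⊎ k ≡ j ⊎ k ≡ suc j) →
          (∀ k → NbT k → suc k ≡ j → NbT (suc j) → ∀ m → NbS m → suc m ≡ c ⊎ m ≡ c ⊎ m ≡ suc c) → ⊥
        twins H₁ H₂ = lem (∃ λ k → NbT k × suc k ≡ j) λ
          { (no none) → small-nbhd (t (pred c) ∷ t (suc c) ∷ s j ∷ s (suc j) ∷ []) ≤-refl
              (t-cover _ (here refl) (there (here refl)) λ k Nk →
                [ (λ e → ⊥-elim (none (k , Nk , e)))
                , [ (λ e → there (there (here (cong s e)))) , (λ e → there (there (there (here (cong s e))))) ]′ ]′ (H₁ k Nk))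
          ; (yes (k , Nk , e)) → lem (NbT (suc j)) λ
              { (no none) → small-nbhd (t (pred c) ∷ t (suc c) ∷ s (pred j) ∷ s j ∷ []) ≤-refl
                  (t-cover _ (here refl) (there (here refl)) λ m Nm →
                    [ (λ e → there (there (here (cong s (cong pred e)))))
                    , [ (λ e → there (there (there (here (cong s e)))))
                      , (λ e → ⊥-elim (none (subst NbT e Nm))) ]′ ]′ (H₁ m Nm))
              ; (yes Nj⁺) → pinned (subst NbT (cong pred e) Nk) Nj⁺
                              (≤-trans (s≤s z≤n) (≤-reflexive e)) (H₂ k Nk e Nj⁺) } }
          where
          pinned : NbT (pred j) → NbT (suc j) → 0 < j →
            (∀ m → NbS m → suc m ≡ c ⊎ m ≡ c ⊎ m ≡ suc c) → ⊥
          pinned (_ , c-j⁻) (j⁺<M , c-j⁺) 0<j H = lem (NbS (pred c)) λ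
            { (no none) → small-nbhd (s (pred j) ∷ s (suc j) ∷ t c ∷ t (suc c) ∷ []) ≤-refl
                (s-cover _ (here refl) (there (here refl)) λ m Nm →
                  [ (λ e → ⊥-elim (none (subst NbS (cong pred e) Nm)))
                  , [ (λ e → there (there (here (cong t e)))) , (λ e → there (there (there (here (cong t e))))) ]′ ]′ (H m Nm))
            ; (yes (_ , j-c⁻)) → lem (NbS (suc c)) λ
                { (no none) → small-nbhd (s (pred j) ∷ s (suc j) ∷ t (pred c) ∷ t c ∷ []) ≤-refl
                    (s-cover _ (here refl) (there (here refl)) λ m Nm →
                      [ (λ e → there (there (here (cong t (cong pred e)))))
                      , [ (λ e → there (there (there (here (cong t e)))))
                        , (λ e → ⊥-elim (none (subst NbS e Nm))) ]′ ]′ (H m Nm))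
                ; (yes (c⁺<N , j-c⁺)) → twin-pair j-c⁻ j-c⁺ c⁺<N } }
            where
            c-j : E (t c) (s j)
            c-j = E-sym (proj₂ Nc)
            Sⱼ : List V
            Sⱼ = s (pred j) ∷ s (suc j) ∷ t (pred c) ∷ t c ∷ t (suc c) ∷ []
            T꜀ : List V
            T꜀ = t (pred c) ∷ t (suc c) ∷ s (pred j) ∷ s j ∷ s (suc j) ∷ []
            s-nbrs : ∀ {w} → E (s j) w → w ∈ Sⱼ
            s-nbrs = s-cover _ (here refl) (there (here refl)) λ m Nm →
              [ (λ e → there (there (here (cong t (cong pred e)))))
              , [ (λ e → there (there (there (here (cong t e)))))
                , (λ e → there (there (there (there (here (cong t e)))))) ]′ ]′ (H m Nm)
            t-nbrs : ∀ {w} → E (t c) w → w ∈ T꜀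
            t-nbrs = t-cover _ (here refl) (there (here refl)) λ m Nm →
              [ (λ e → there (there (here (cong s (cong pred e)))))
              , [ (λ e → there (there (there (here (cong s e)))))
                , (λ e → there (there (there (there (here (cong s e)))))) ]′ ]′ (H₁ m Nm)
            twin-pair : E (s j) (t (pred c)) → E (s j) (t (suc c)) → suc c < N → ⊥
            twin-pair j-c⁻ j-c⁺ c⁺<N = noTwins (s j) (t c)
              ((λ e → E-irrefl (subst (E (t c)) e c-j)) ,
               (λ w → ≡true-ext (λ e → closed⁺ (s⇒t w (closed⁻ e))) (λ e → closed⁺ (t⇒s w (closed⁻ e)))))
              (deg≡5 Sⱼ refl s-nbrs) (deg≡5 T꜀ refl t-nbrs)
              where
              c-c⁻ : E (t c) (t (pred c))
              c-c⁻ = E-sym (step-pred T (≤-<-trans z≤n (proj₁ (inner Nc))) (proj₁ Nc))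
              j-j⁻ : E (s j) (s (pred j))
              j-j⁻ = E-sym (step-pred S 0<j j<M)
              s⇒t : ∀ w → s j ≡ w ⊎ E (s j) w → t c ≡ w ⊎ E (t c) w
              s⇒t w (inj₁ refl) = inj₂ c-j
              s⇒t w (inj₂ e) with s-nbrs e
              ... | here refl = inj₂ c-j⁻
              ... | there (here refl) = inj₂ c-j⁺
              ... | there (there (here refl)) = inj₂ c-c⁻
              ... | there (there (there (here refl))) = inj₁ refl
              ... | there (there (there (there (here refl)))) = inj₂ (t-steps c c⁺<N)
              t⇒s : ∀ w → t c ≡ w ⊎ E (t c) w → s j ≡ w ⊎ E (s j) w
              t⇒s w (inj₁ refl) = inj₂ (proj₂ Nc)
              t⇒s w (inj₂ e) with t-nbrs e
              ... | here refl = inj₂ j-c⁻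
              ... | there (here refl) = inj₂ j-c⁺
              ... | there (there (here refl)) = inj₂ j-j⁻
              ... | there (there (there (here refl))) = inj₁ refl
              ... | there (there (there (there (here refl)))) = inj₂ (s-steps j j⁺<M)

        module _ {lo hi Lo Hi : ℕ} (Nlo : NbS lo) (Nhi : NbS hi) (lo<c : lo < c) (c<hi : c < hi)
          (lo≤ : ∀ k → NbS k → lo ≤ k) (≤hi : ∀ k → NbS k → k ≤ hi)
          (Lo≤ : ∀ k → NbT k → Lo ≤ k) (≤Hi : ∀ k → NbT k → k ≤ Hi) where

          Nj : NbT j
          Nj = j<M , E-sym (proj₂ Nc)

          tight : ∀ {a x} → ¬ (suc a < x) → a < x → x ≡ suc a
          tight ¬lt a<x = ≤-antisym (≮⇒≥ ¬lt) a<x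

          -- If no loose pair exists, the nonextreme edge s_j t_c pins both neighbourhoods down.
          loose-crossing : ¬ ¬ Loose Crossing Lo Hi lo hi
          loose-crossing none = twins
            (λ k Nk → classify k Nk (<-cmp k j))
            (λ k Nk k+1≡j Nj⁺ m Nm → pin k Nk k+1≡j Nj⁺ m Nm (<-cmp m c))
            where
            -- The edges from `s j` to `t h` and from `s k` to `t c` cross; not being loose, they
            -- join consecutive positions. Since `lo` and `hi` lie on different sides of `c`, every
            -- neighbour `s k` of `t c` other than `s j` has such a partner.
            up : ∀ k h → NbT k → NbS h → j < k → c < h → k ≡ suc j × h ≡ suc c
            up k h Nk Nh j<k c<h = tight (λ lt → none (pair (inj₁ lt))) j<k , tight (λ lt → none (pair (inj₂ lt))) c<h
              where
              pair : suc j < k ⊎ suc c < h → Loose Crossing Lo Hi lo hi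
              pair sl = j , k , c , h , Lo≤ j Nj , j<k , ≤Hi k Nk , <⇒≤ lo<c , c<h , ≤hi h Nh ,
                (proj₂ Nh , E-sym (proj₂ Nk)) , sl
            down : ∀ k l → NbT k → NbS l → k < j → l < c → j ≡ suc k × c ≡ suc l
            down k l Nk Nl k<j l<c = tight (λ lt → none (pair (inj₁ lt))) k<j , tight (λ lt → none (pair (inj₂ lt))) l<c
              where
              pair : suc k < j ⊎ suc l < c → Loose Crossing Lo Hi lo hi
              pair sl = k , j , l , c , Lo≤ k Nk , k<j , ≤Hi j Nj , lo≤ l Nl , l<c , <⇒≤ c<hi ,
                (E-sym (proj₂ Nk) , proj₂ Nl) , sl
            classify : ∀ k → NbT k → _ → suc k ≡ j ⊎ k ≡ j ⊎ k ≡ suc j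
            classify k Nk (tri< k<j _ _) = inj₁ (≡-sym (proj₁ (down k lo Nk Nlo k<j lo<c)))
            classify k Nk (tri≈ _ e _) = inj₂ (inj₁ e)
            classify k Nk (tri> _ _ j<k) = inj₂ (inj₂ (proj₁ (up k hi Nk Nhi j<k c<hi)))
            pin : ∀ k → NbT k → suc k ≡ j → NbT (suc j) → ∀ m → NbS m → _ → suc m ≡ c ⊎ m ≡ c ⊎ m ≡ suc c
            pin k Nk e Nj⁺ m Nm (tri< m<c _ _) = inj₁ (≡-sym (proj₂ (down k m Nk Nm (≤-reflexive e) m<c)))
            pin k Nk e Nj⁺ m Nm (tri≈ _ e′ _) = inj₂ (inj₁ e′)
            pin k Nk e Nj⁺ m Nm (tri> _ _ c<m) = inj₂ (inj₂ (proj₂ (up (suc j) m Nj⁺ Nm (n<1+n j) c<m)))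

          -- The mirror image along `T`: neighbours of `t c` after `s j` are paired with neighbours
          -- of `s j` before `t c`, and conversely.
          loose-parallel : ¬ ¬ Loose Parallel Lo Hi lo hi
          loose-parallel none = twins
            (λ k Nk → classify k Nk (<-cmp k j))
            (λ k Nk k+1≡j Nj⁺ m Nm → pin k Nk k+1≡j Nj⁺ m Nm (<-cmp m c))
            where
            up : ∀ k l → NbT k → NbS l → j < k → l < c → k ≡ suc j × c ≡ suc l
            up k l Nk Nl j<k l<c = tight (λ lt → none (pair (inj₁ lt))) j<k , tight (λ lt → none (pair (inj₂ lt))) l<c
              where
              pair : suc j < k ⊎ suc l < c → Loose Parallel Lo Hi lo hi
              pair sl = j , k , l , c , Lo≤ j Nj , j<k , ≤Hi k Nk , lo≤ l Nl , l<c , <⇒≤ c<hi ,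
                (proj₂ Nl , E-sym (proj₂ Nk)) , sl
            down : ∀ k h → NbT k → NbS h → k < j → c < h → j ≡ suc k × h ≡ suc c
            down k h Nk Nh k<j c<h = tight (λ lt → none (pair (inj₁ lt))) k<j , tight (λ lt → none (pair (inj₂ lt))) c<h
              where
              pair : suc k < j ⊎ suc c < h → Loose Parallel Lo Hi lo hi
              pair sl = k , j , c , h , Lo≤ k Nk , k<j , ≤Hi j Nj , <⇒≤ lo<c , c<h , ≤hi h Nh ,
                (E-sym (proj₂ Nk) , proj₂ Nh) , sl
            classify : ∀ k → NbT k → _ → suc k ≡ j ⊎ k ≡ j ⊎ k ≡ suc j
            classify k Nk (tri< k<j _ _) = inj₁ (≡-sym (proj₁ (down k hi Nk Nhi k<j c<hi)))
            classify k Nk (tri≈ _ e _) = inj₂ (inj₁ e)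
            classify k Nk (tri> _ _ j<k) = inj₂ (inj₂ (proj₁ (up k lo Nk Nlo j<k lo<c)))
            pin : ∀ k → NbT k → suc k ≡ j → NbT (suc j) → ∀ m → NbS m → _ → suc m ≡ c ⊎ m ≡ c ⊎ m ≡ suc c
            pin k Nk e Nj⁺ m Nm (tri< m<c _ _) = inj₁ (≡-sym (proj₂ (up (suc j) m Nj⁺ Nm (n<1+n j) m<c)))
            pin k Nk e Nj⁺ m Nm (tri≈ _ e′ _) = inj₂ (inj₁ e′)
            pin k Nk e Nj⁺ m Nm (tri> _ _ c<m) = inj₂ (inj₂ (proj₂ (down k m Nk Nm (≤-reflexive e) c<m)))

      -- At most two neighbours of `s j` lie on `S`, so at least three lie on `T`, and one of them
      -- is not extreme.
      window : (∀ (w : Window) → Window.j w ≡ j → ⊥) → ⊥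
      window κ = lem (∃ NbS) λ
        { (no none) → small-nbhd (s (pred j) ∷ s (suc j) ∷ []) (s≤s (s≤s z≤n))
            (s-cover _ (here refl) (there (here refl)) λ k Nk → ⊥-elim (none (k , Nk)))
        ; (yes (k , Nk)) → extremes NbS proj₁ k Nk λ lo hi Nlo Nhi lo≤ ≤hi →
          lem (∃ λ c → lo < c × c < hi × NbS c) λ
            { (no none) → small-nbhd (s (pred j) ∷ s (suc j) ∷ t lo ∷ t hi ∷ []) ≤-refl
                (s-cover _ (here refl) (there (here refl)) λ k Nk → ends none (lo≤ k Nk) (≤hi k Nk) Nk)
            ; (yes (c , lo<c , c<hi , Nc)) → extremes (NbT Nc) proj₁ j (Nj′ Nc) λ Lo Hi NLo NHi Lo≤ ≤Hi →
                loose-crossing Nc Nlo Nhi lo<c c<hi lo≤ ≤hi Lo≤ ≤Hi λ cr →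
                loose-parallel Nc Nlo Nhi lo<c c<hi lo≤ ≤hi Lo≤ ≤Hi λ pa →
                κ (record { j = j ; lo = lo ; c = c ; hi = hi ; Lo = Lo ; Hi = Hi ; j<M = j<M
                          ; lo<c = lo<c ; c<hi = c<hi ; hi<N = proj₁ Nhi ; j-lo = proj₂ Nlo ; j-hi = proj₂ Nhi
                          ; Hi<M = proj₁ NHi ; c-Lo = proj₂ NLo ; c-Hi = proj₂ NHi
                          ; crossing = cr ; parallel = pa }) refl } }
        where
        Nj′ : ∀ {c} (Nc : NbS c) → NbT Nc j
        Nj′ Nc = j<M , E-sym (proj₂ Nc)
        ends : ∀ {lo hi k} → ¬ (∃ λ c → lo < c × c < hi × NbS c) → lo ≤ k → k ≤ hi → NbS k →
          t k ∈ s (pred j) ∷ s (suc j) ∷ t lo ∷ t hi ∷ []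
        ends none lo≤k k≤hi Nk with m≤n⇒m<n∨m≡n lo≤k | m≤n⇒m<n∨m≡n k≤hi
        ... | inj₂ refl | _ = there (there (here refl))
        ... | inj₁ _ | inj₂ refl = there (there (there (here refl)))
        ... | inj₁ lo<k | inj₁ k<hi = ⊥-elim (none (_ , lo<k , k<hi , Nk))
        extremes : ∀ {B} (Nb : ℕ → Set) → (∀ {k} → Nb k → k < B) → ∀ k → Nb k →
          (∀ lo hi → Nb lo → Nb hi → (∀ i → Nb i → lo ≤ i) → (∀ i → Nb i → i ≤ hi) → ⊥) → ⊥
        extremes {zero} Nb bd k Nk κ = ⊥-elim (<⇒≱ (bd Nk) z≤n)
        extremes {suc B} Nb bd k Nk κ =
          firstAfter Nb k Nk k 0 refl λ lo _ _ Nlo below →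
          lastBefore Nb k Nk B (≤-pred (bd Nk)) λ hi _ _ Nhi above →
          κ lo hi Nlo Nhi (λ i Ni → ≮⇒≥ (λ i<lo → below i z≤n i<lo Ni))
            (λ i Ni → ≮⇒≥ (λ hi<i → above i hi<i (≤-pred (bd Ni)) Ni))

  module _ (S∩T : Disj OnS OnT) where

    -- The data of an exchange: `S` leaves at `p`, runs through the part of `T` from `e` to `f` and
    -- returns at `q`, while `T` leaves at `u`, runs through the part of `S` from `g` to `h` and
    -- returns at `v`. By `slack` some vertex is skipped by both.
    record Block : Set where
      field
        p q u v e f g h : ℕ
        p<g : p < g
        g≤h : g ≤ h
        h<q : h < q
        q<M : q < M
        u<e : u < e
        e≤f : e ≤ f
        f<v : f < v
        v<N : v < N
        p-T : ∃ λ w → Seg t e (suc f) w × E (s p) w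
        q-T : ∃ λ w → Seg t e (suc f) w × E (s q) w
        u-S : ∃ λ w → Seg s g (suc h) w × E (t u) w
        v-S : ∃ λ w → Seg s g (suc h) w × E (t v) w
        slack : suc p < g ⊎ suc u < e ⊎ suc f < v
      p<q : p < q
      p<q = <-trans p<g (≤-<-trans g≤h h<q)
      u<v : u < v
      u<v = <-trans u<e (≤-<-trans e≤f f<v)

    Separated : Window → Window → Set
    Separated x y = Window.Hi y ≤ Window.Lo x ×
      (Window.hi x ≤ Window.lo y ⊎ Window.hi y ≤ Window.lo x)

    -- `l` precedes `r` along `S`. If it does so along `T` as well, crossing pairs at both windows
    -- give the exchange; if the order along `T` is reversed, parallel pairs do. The slack comes
    -- from the pair at `l`.
    block : (r l : Window) → Separated r l → ∃ λ b → Window.Lo l ≤ Block.p b × Block.q b ≤ Window.Hi r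
    block r l (Hl≤Lr , inj₂ hl≤lr) with Window.crossing l | Window.crossing r
    ... | a , x , b , u , Lo≤a , a<x , x≤Hi , lo≤b , b<u , u≤hi , (au , xb) , sl
        | a′ , x′ , b′ , u′ , Lo≤a′ , a′<x′ , x′≤Hi , lo≤b′ , b′<u′ , u′≤hi , (au′ , xb′) , _ =
      record
        { p = a ; q = x′ ; u = b ; v = u′ ; e = u ; f = b′ ; g = x ; h = a′
        ; p<g = a<x ; g≤h = x≤a′ ; h<q = a′<x′ ; q<M = ≤-<-trans x′≤Hi (Window.Hi<M r)
        ; u<e = b<u ; e≤f = u≤b′ ; f<v = b′<u′ ; v<N = ≤-<-trans u′≤hi (Window.hi<N r)
        ; p-T = t u , (u , ≤-refl , s≤s u≤b′ , refl) , au
        ; q-T = t b′ , (b′ , u≤b′ , ≤-refl , refl) , xb′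
        ; u-S = s x , (x , ≤-refl , s≤s x≤a′ , refl) , E-sym xb
        ; v-S = s a′ , (a′ , x≤a′ , ≤-refl , refl) , E-sym au′
        ; slack = [ inj₁ , inj₂ ∘ inj₁ ]′ sl } , Lo≤a , x′≤Hi
      where
      x≤a′ : x ≤ a′
      x≤a′ = ≤-trans x≤Hi (≤-trans Hl≤Lr Lo≤a′)
      u≤b′ : u ≤ b′
      u≤b′ = ≤-trans u≤hi (≤-trans hl≤lr lo≤b′)
    block r l (Hl≤Lr , inj₁ hr≤ll) with Window.parallel l | Window.parallel r
    ... | a , x , b , u , Lo≤a , a<x , x≤Hi , lo≤b , b<u , u≤hi , (ab , xu) , sl
        | a′ , x′ , b′ , u′ , Lo≤a′ , a′<x′ , x′≤Hi , lo≤b′ , b′<u′ , u′≤hi , (ab′ , xu′) , _ =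
      record
        { p = a ; q = x′ ; u = b′ ; v = u ; e = u′ ; f = b ; g = x ; h = a′
        ; p<g = a<x ; g≤h = x≤a′ ; h<q = a′<x′ ; q<M = ≤-<-trans x′≤Hi (Window.Hi<M r)
        ; u<e = b′<u′ ; e≤f = u′≤b ; f<v = b<u ; v<N = ≤-<-trans u≤hi (Window.hi<N l)
        ; p-T = t b , (b , u′≤b , ≤-refl , refl) , ab
        ; q-T = t u′ , (u′ , ≤-refl , s≤s u′≤b , refl) , xu′
        ; u-S = s a′ , (a′ , x≤a′ , ≤-refl , refl) , E-sym ab′
        ; v-S = s x , (x , ≤-refl , s≤s x≤a′ , refl) , E-sym xu
        ; slack = [ inj₁ , inj₂ ∘ inj₂ ]′ sl } , Lo≤a , x′≤Hi
      where
      x≤a′ : x ≤ a′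
      x≤a′ = ≤-trans x≤Hi (≤-trans Hl≤Lr Lo≤a′)
      u′≤b : u′ ≤ b
      u′≤b = ≤-trans u′≤hi (≤-trans hr≤ll lo≤b)

    -- Windows are consumed in pairs. The last component serves the induction: it places the blocks
    -- of the remaining windows before the current block along `S`.
    blocks : ∀ k (ws : List Window) → AllPairs Separated ws → length ws ≡ k * 2 →
      ∃ λ bs → length bs ≡ k × AllPairs (λ b b′ → Block.q b′ ≤ Block.p b) bs ×
        All (λ b → ∃ λ w → w ∈ ws × Block.q b ≤ Window.Hi w) bs
    blocks zero ws ap e = [] , refl , [] , []
    blocks (suc k) (r ∷ l ∷ ws) ((rl ∷ _) ∷ (a ∷ ap)) e
      with block r l rl | blocks k ws ap (suc-injective (suc-injective e))
    ... | b , Lo≤p , q≤Hi | bs , e′ , ap′ , bound =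
      b ∷ bs , cong suc e′ ,
      All.map (λ (w , w∈ , q≤) → ≤-trans q≤ (≤-trans (proj₁ (All.lookup a w∈)) Lo≤p)) bound ∷ ap′ ,
      (r , here refl , q≤Hi) ∷ All.map (λ (w , w∈ , q≤) → w , there (there w∈) , q≤) bound

    prefix-suffix-disj : ∀ (P : Path) {i} → i ≤ Path.len P →
      Disj (Seg (Path.at P) 0 i) (Seg (Path.at P) i (Path.len P))
    prefix-suffix-disj P i≤ v (k , _ , k< , refl) (j , ≤j , j< , eq) =
      <⇒≱ k< (≤-trans ≤j (≤-reflexive (≡-sym (Path.inj P (<-≤-trans k< i≤) j< eq))))

    -- Exchanging s[g..h] and t[e..f] inside each block keeps both rails connected, and the slack
    -- of the block is a rung between the new rails.
    no-disjoint-blocks : (bs : List Block) → length bs ≡ ℓ →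
      AllPairs (λ b b′ → Block.q b ≤ Block.p b′ ⊎ Block.q b′ ≤ Block.p b) bs →
      AllPairs (λ b b′ → Block.v b ≤ Block.u b′ ⊎ Block.v b′ ≤ Block.u b) bs → ⊥
    no-disjoint-blocks bs len≡ apS apT = <-irrefl len≡
      (K2-minor 1≤ℓ noK A B F bs
        (RS.rail-conn (λ {b} _ → p<q b) apS s-steps (λ {b} _ → q<M b)
          (λ {b} _ → seg-conn t-steps (e b) (suc (f b)) (<-trans (f<v b) (v<N b)))
          (λ {b} _ → p-T b) (λ {b} _ → q-T b))
        (RT.rail-conn (λ {b} _ → u<v b) apT t-steps (λ {b} _ → v<N b)
          (λ {b} _ → seg-conn s-steps (g b) (suc (h b)) (<-trans (h<q b) (q<M b)))
          (λ {b} _ → u-S b) (λ {b} _ → v-S b))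
        A∩B rungs
        (AllPairs-map-∈ bs (λ { {b} {b′} _ _ (d , d′) w Fw Fw′ → F∩F b b′ d d′ (F-part b Fw) (F-part b′ Fw′) })
          (AllPairs.zip (apS , apT))))
      where
      open Block
      D-S D-T : Block → V → Set
      D-S b = Seg t (e b) (suc (f b))
      D-T b = Seg s (g b) (suc (h b))
      module RS = Reroute s M p q bs D-S
      module RT = Reroute t N u v bs D-T
      A B : V → Set
      A = RS.Rail
      B = RT.Rail
      freed : ∀ b → suc (p b) < g b ⊎ suc (u b) < e b ⊎ suc (f b) < v b → V → Set
      freed b (inj₁ _) = Seg s (suc (p b)) (g b)
      freed b (inj₂ (inj₁ _)) = Seg t (suc (u b)) (e b)
      freed b (inj₂ (inj₂ _)) = Seg t (suc (f b)) (v b)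
      F : Block → V → Set
      F b = freed b (slack b)
      -- One description of the freed vertices for all kinds of slack, from which every disjointness
      -- follows.
      Part : Block → V → Set
      Part b w = (∃ λ k → p b < k × k < q b × ¬ (g b ≤ k × k ≤ h b) × w ≡ s k) ⊎
                 (∃ λ k → u b < k × k < v b × ¬ (e b ≤ k × k ≤ f b) × w ≡ t k)
      F-part : ∀ b {w} → F b w → Part b w
      F-part b = go (slack b)
        where
        go : ∀ sl {w} → freed b sl w → Part b w
        go (inj₁ _) (k , <k , k< , eq) =
          inj₁ (k , <k , <-trans k< (≤-<-trans (g≤h b) (h<q b)) , (λ (g≤ , _) → <⇒≱ k< g≤) , eq)
        go (inj₂ (inj₁ _)) (k , <k , k< , eq) =
          inj₂ (k , <k , <-trans k< (≤-<-trans (e≤f b) (f<v b)) , (λ (e≤ , _) → <⇒≱ k< e≤) , eq)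
        go (inj₂ (inj₂ _)) (k , <k , k< , eq) =
          inj₂ (k , <-trans (<-≤-trans (u<e b) (e≤f b)) <k , k< , (λ (_ , ≤f) → <⇒≱ <k ≤f) , eq)
      s≠t : ∀ {w i j} → i < M → j < N → w ≡ s i → w ≡ t j → ⊥
      s≠t i< j< ws wt = S∩T _ (_ , z≤n , i< , ws) (_ , z≤n , j< , wt)
      s-eq : ∀ {w i j} → i < M → j < M → w ≡ s i → w ≡ s j → i ≡ j
      s-eq i< j< wi wj = s-inj i< j< (trans (≡-sym wi) wj)
      t-eq : ∀ {w i j} → i < N → j < N → w ≡ t i → w ≡ t j → i ≡ j
      t-eq i< j< wi wj = t-inj i< j< (trans (≡-sym wi) wj)
      in-S : ∀ b {k} → g b ≤ k → k ≤ h b → p b < k × k < q b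
      in-S b g≤ ≤h = <-≤-trans (p<g b) g≤ , ≤-<-trans ≤h (h<q b)
      in-T : ∀ b {k} → e b ≤ k → k ≤ f b → u b < k × k < v b
      in-T b e≤ ≤f = <-≤-trans (u<e b) e≤ , ≤-<-trans ≤f (f<v b)
      <M : ∀ b {k} → k < q b → k < M
      <M b k< = <-trans k< (q<M b)
      <N : ∀ b {k} → k < v b → k < N
      <N b k< = <-trans k< (v<N b)
      A∩B : Disj A B
      A∩B w (inj₁ (k , k< , out , wk)) (inj₁ (m , m< , _ , wm)) = s≠t k< m< wk wm
      A∩B w (inj₁ (k , k< , out , wk)) (inj₂ (b , b∈ , m , g≤ , s≤s ≤h , wm)) with in-S b g≤ ≤h
      ... | p< , <q with s-eq k< (<M b <q) wk wm
      ... | refl = out b∈ p< <q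
      A∩B w (inj₂ (b , b∈ , m , e≤ , s≤s ≤f , wm)) (inj₁ (k , k< , out , wk)) with in-T b e≤ ≤f
      ... | u< , <v with t-eq k< (<N b <v) wk wm
      ... | refl = out b∈ u< <v
      A∩B w (inj₂ (b , _ , m , e≤ , s≤s ≤f , wm)) (inj₂ (b′ , _ , k , g≤ , s≤s ≤h , wk)) =
        s≠t (<M b′ (proj₂ (in-S b′ g≤ ≤h))) (<N b (proj₂ (in-T b e≤ ≤f))) wk wm
      A∩F : ∀ {b} → b ∈ bs → ∀ w → A w → Part b w → ⊥
      A∩F {b} b∈ w (inj₁ (k , k< , out , wk)) (inj₁ (m , p< , <q , _ , wm)) with s-eq k< (<M b <q) wk wm
      ... | refl = out b∈ p< <q
      A∩F {b} b∈ w (inj₁ (k , k< , out , wk)) (inj₂ (m , _ , <v , _ , wm)) = s≠t k< (<N b <v) wk wm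
      A∩F {b} b∈ w (inj₂ (b′ , _ , m , e≤ , s≤s ≤f , wm)) (inj₁ (k , _ , <q , _ , wk)) =
        s≠t (<M b <q) (<N b′ (proj₂ (in-T b′ e≤ ≤f))) wk wm
      A∩F {b} b∈ w (inj₂ (b′ , b′∈ , m , e≤ , s≤s ≤f , wm)) (inj₂ (k , u< , <v , ¬ef , wk)) with in-T b′ e≤ ≤f
      ... | u′< , <v′ with t-eq (<N b′ <v′) (<N b <v) wm wk
      ... | refl with AllPairs⇒≡∨ bs (λ {x} {y} → RT.Apart-sym {x} {y}) apT b∈ b′∈
      ... | inj₁ refl = ¬ef (e≤ , ≤f)
      ... | inj₂ (inj₁ le) = <⇒≱ (<-trans u′< <v) le
      ... | inj₂ (inj₂ le) = <⇒≱ (<-trans u< <v′) le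
      B∩F : ∀ {b} → b ∈ bs → ∀ w → B w → Part b w → ⊥
      B∩F {b} b∈ w (inj₁ (k , k< , out , wk)) (inj₂ (m , u< , <v , _ , wm)) with t-eq k< (<N b <v) wk wm
      ... | refl = out b∈ u< <v
      B∩F {b} b∈ w (inj₁ (k , k< , out , wk)) (inj₁ (m , _ , <q , _ , wm)) = s≠t (<M b <q) k< wm wk
      B∩F {b} b∈ w (inj₂ (b′ , _ , m , g≤ , s≤s ≤h , wm)) (inj₂ (k , _ , <v , _ , wk)) =
        s≠t (<M b′ (proj₂ (in-S b′ g≤ ≤h))) (<N b <v) wm wk
      B∩F {b} b∈ w (inj₂ (b′ , b′∈ , m , g≤ , s≤s ≤h , wm)) (inj₁ (k , p< , <q , ¬gh , wk)) with in-S b′ g≤ ≤h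
      ... | p′< , <q′ with s-eq (<M b′ <q′) (<M b <q) wm wk
      ... | refl with AllPairs⇒≡∨ bs (λ {x} {y} → RS.Apart-sym {x} {y}) apS b∈ b′∈
      ... | inj₁ refl = ¬gh (g≤ , ≤h)
      ... | inj₂ (inj₁ le) = <⇒≱ (<-trans p′< <q) le
      ... | inj₂ (inj₂ le) = <⇒≱ (<-trans p< <q′) le
      F∩F : ∀ b b′ → RS.Apart b b′ → RT.Apart b b′ → ∀ {w} → Part b w → Part b′ w → ⊥
      F∩F b b′ d d′ (inj₁ (k , p< , <q , _ , wk)) (inj₁ (m , p′< , <q′ , _ , wm)) with s-eq (<M b <q) (<M b′ <q′) wk wm
      ... | refl = [ <⇒≱ (<-trans p′< <q) , <⇒≱ (<-trans p< <q′) ]′ d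
      F∩F b b′ d d′ (inj₁ (k , _ , <q , _ , wk)) (inj₂ (m , _ , <v , _ , wm)) = s≠t (<M b <q) (<N b′ <v) wk wm
      F∩F b b′ d d′ (inj₂ (k , _ , <v , _ , wk)) (inj₁ (m , _ , <q , _ , wm)) = s≠t (<M b′ <q) (<N b <v) wm wk
      F∩F b b′ d d′ (inj₂ (k , u< , <v , _ , wk)) (inj₂ (m , u′< , <v′ , _ , wm)) with t-eq (<N b <v) (<N b′ <v′) wk wm
      ... | refl = [ <⇒≱ (<-trans u′< <v) , <⇒≱ (<-trans u< <v′) ]′ d′
      last-in : ∀ (P : Path) {i j} → i < j → j < Path.len P →
        ∃ λ w → Seg (Path.at P) i j w × E w (Path.at P j)
      last-in P {i} {suc j} i<j j< = _ , (j , ≤-pred i<j , ≤-refl , refl) , Path.steps P j j<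
      rungs : ∀ {b} → b ∈ bs → Rung A B (F b)
      rungs {b} b∈ = record
        { R-conn = proj₁ (ends (slack b))
        ; R-A = proj₁ (proj₂ (ends (slack b)))
        ; R-B = proj₂ (proj₂ (ends (slack b)))
        ; A-disj = λ w Aw Fw → A∩F b∈ w Aw (F-part b Fw)
        ; B-disj = λ w Bw Fw → B∩F b∈ w Bw (F-part b Fw) }
        where
        s-p∈A : A (s (p b))
        s-p∈A = inj₁ (p b , <M b (p<q b) , RS.lo-outside (λ {b} _ → p<q b) apS b∈ , refl)
        t-u∈B : B (t (u b))
        t-u∈B = inj₁ (u b , <N b (u<v b) , RT.lo-outside (λ {b} _ → u<v b) apT b∈ , refl)
        t-v∈B : B (t (v b))
        t-v∈B = inj₁ (v b , v<N b , RT.hi-outside (λ {b} _ → u<v b) apT b∈ , refl)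
        g<M : g b < M
        g<M = <M b (≤-<-trans (g≤h b) (h<q b))
        e<N : e b < N
        e<N = <N b (≤-<-trans (e≤f b) (f<v b))
        ends : ∀ sl → Conn (freed b sl) × Sees (freed b sl) A × Sees (freed b sl) B
        ends (inj₁ p+1<g) = seg-conn s-steps _ _ (<⇒≤ g<M) ,
          (s (suc (p b)) , s (p b) , (suc (p b) , ≤-refl , p+1<g , refl) , s-p∈A ,
            E-sym (s-steps (p b) (<-trans p+1<g g<M))) ,
          (let (w , Fw , ew) = last-in S p+1<g g<M in
            w , s (g b) , Fw , inj₂ (b , b∈ , g b , ≤-refl , s≤s (g≤h b) , refl) , ew)
        ends (inj₂ (inj₁ u+1<e)) = seg-conn t-steps _ _ (<⇒≤ e<N) ,
          (let (w , Fw , ew) = last-in T u+1<e e<N in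
            w , t (e b) , Fw , inj₂ (b , b∈ , e b , ≤-refl , s≤s (e≤f b) , refl) , ew) ,
          (t (suc (u b)) , t (u b) , (suc (u b) , ≤-refl , u+1<e , refl) , t-u∈B ,
            E-sym (t-steps (u b) (<-trans u+1<e e<N)))
        ends (inj₂ (inj₂ f+1<v)) = seg-conn t-steps _ _ (<⇒≤ (v<N b)) ,
          (t (suc (f b)) , t (f b) , (suc (f b) , ≤-refl , f+1<v , refl) ,
            inj₂ (b , b∈ , f b , e≤f b , ≤-refl , refl) ,
            E-sym (t-steps (f b) (<-trans f+1<v (v<N b)))) ,
          (let (w , Fw , ew) = last-in T f+1<v (v<N b) in w , t (v b) , Fw , t-v∈B , ew)

    -- The blocks are disjoint along `S` already. If many of their intervals on `T` covered one
    -- edge, the two parts of `T` would be rails and the exchanged parts of `S` rungs. So `ℓ` of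
    -- them are disjoint along `T` too.
    no-blocks : (bs : List Block) → length bs ≡ ℓ * suc ℓ →
      AllPairs (λ b b′ → Block.q b′ ≤ Block.p b) bs → ⊥
    no-blocks bs len≡ ap = greedy u (λ b b′ → u b < v b′) ℓ ℓ bs few (≤-reflexive (≡-sym len≡)) λ ys e ys∈ ap′ →
      no-disjoint-blocks ys e
        (AllPairs-map-∈ ys (λ {x} {y} x∈ y∈ (_ , u≮v) →
          [ (λ { refl → ⊥-elim (u≮v (u<v x)) }) , id ]′
            (AllPairs⇒≡∨ bs [ inj₂ , inj₁ ]′ (AllPairs.map inj₂ ap) (All.lookup ys∈ x∈) (All.lookup ys∈ y∈))) ap′)
        (AllPairs.map (λ (_ , u≮v) → inj₂ (≮⇒≥ u≮v)) ap′)
      where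
      open Block
      few : ∀ {b} → b ∈ bs → ∀ ys → ys ⊆ bs → All (λ y → u y ≤ u b × u b < v y) ys → length ys ≤ ℓ
      few {b} _ ys sub a = <⇒≤
        (K2-minor 1≤ℓ noK (Seg t 0 (suc (u b))) (Seg t (suc (u b)) N) (λ y → Seg s (g y) (suc (h y))) ys
          (seg-conn t-steps 0 _ u<N) (seg-conn t-steps _ N ≤-refl) (prefix-suffix-disj T u<N)
          (λ {y} y∈ → let (uy≤ , <vy) = All.lookup a y∈
                          (w , Sw , ew) = u-S y
                          (w′ , Sw′ , ew′) = v-S y
                          inM = <-trans (h<q y) (q<M y) in record
            { R-conn = seg-conn s-steps (g y) (suc (h y)) inM
            ; R-A = w , t (u y) , Sw , (u y , z≤n , s≤s uy≤ , refl) , E-sym ew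
            ; R-B = w′ , t (v y) , Sw′ , (v y , <vy , v<N y , refl) , E-sym ew′
            ; A-disj = λ { x (k , _ , k< , wk) (m , _ , s≤s m≤ , wm) →
                S∩T x (m , z≤n , ≤-<-trans m≤ inM , wm) (k , z≤n , <-≤-trans k< u<N , wk) }
            ; B-disj = λ { x (k , _ , k< , wk) (m , _ , s≤s m≤ , wm) →
                S∩T x (m , z≤n , ≤-<-trans m≤ inM , wm) (k , z≤n , k< , wk) } })
          (AllPairs.map (λ { {y} {y′} q≤p x (k , g≤k , s≤s k≤h , wk) (m , g≤m , s≤s m≤h , wm) →
              let k≡m = s-inj (≤-<-trans k≤h (<-trans (h<q y) (q<M y))) (≤-<-trans m≤h (<-trans (h<q y′) (q<M y′)))
                          (trans (≡-sym wk) wm) in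
              <⇒≱ (<-trans (≤-<-trans m≤h (h<q y′)) (≤-<-trans q≤p (<-≤-trans (p<g y) g≤k))) (≤-reflexive k≡m) })
            (AllPairs-resp-⊆ sub ap)))
        where
        u<N : u b < N
        u<N = <-trans (u<v b) (v<N b)

    -- The intervals from `lo` to `hi` are made disjoint first, the vertices `s j` being rungs for
    -- overlapping ones. This makes the positions `c` distinct, so that the vertices `t c` can be
    -- rungs when the intervals from `Lo` to `Hi` are treated in the same way.
    no-windows : (ws : List Window) → AllPairs (λ w w′ → Window.j w ≢ Window.j w′) ws → rail-bound ℓ ≤ length ws → ⊥
    no-windows ws uniq big =
      greedy lo (λ x y → lo x < hi y) ℓ ((ℓ * suc ℓ) * 2 * suc ℓ) ws few-lo big λ xs xs-len xs∈ xs-ap →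
      greedy Lo (λ x y → Lo x < Hi y) ℓ ((ℓ * suc ℓ) * 2) xs (few-Lo xs xs-ap) (≤-reflexive (≡-sym xs-len)) λ ys ys-len ys∈ ys-ap →
      let (bs , bs-len , bs-ap , _) = blocks (ℓ * suc ℓ) ys
            (AllPairs-map-∈ ys (λ {x} {y} x∈ y∈ (_ , Lo≮Hi) → ≮⇒≥ Lo≮Hi ,
              [ (λ { refl → ⊥-elim (Lo≮Hi (Lo<Hi x)) }) , id ]′
                (AllPairs⇒≡∨ xs [ inj₂ , inj₁ ]′ (AllPairs.map (λ (_ , lo≮hi) → inj₂ (≮⇒≥ lo≮hi)) xs-ap)
                  (All.lookup ys∈ x∈) (All.lookup ys∈ y∈))) ys-ap) ys-len in
      no-blocks bs bs-len bs-ap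
      where
      open Window
      few-lo : ∀ {x} → x ∈ ws → ∀ ys → ys ⊆ ws → All (λ y → lo y ≤ lo x × lo x < hi y) ys → length ys ≤ ℓ
      few-lo {x} _ ys sub a = <⇒≤
        (K2-minor 1≤ℓ noK (Seg t 0 (suc (lo x))) (Seg t (suc (lo x)) N) (λ y v → v ≡ s (j y)) ys
          (seg-conn t-steps 0 _ lo<N) (seg-conn t-steps _ N ≤-refl) (prefix-suffix-disj T lo<N)
          (λ {y} y∈ → let (lo≤ , <hi) = All.lookup a y∈ in record
            { R-conn = λ { u v refl refl → here refl }
            ; R-A = s (j y) , t (lo y) , refl , (lo y , z≤n , s≤s lo≤ , refl) , j-lo y
            ; R-B = s (j y) , t (hi y) , refl , (hi y , <hi , hi<N y , refl) , j-hi y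
            ; A-disj = λ { v (k , _ , k< , vk) vs → S∩T v (j y , z≤n , j<M y , vs) (k , z≤n , <-≤-trans k< lo<N , vk) }
            ; B-disj = λ { v (k , _ , k< , vk) vs → S∩T v (j y , z≤n , j<M y , vs) (k , z≤n , k< , vk) } })
          (AllPairs.map (λ {y} {y′} j≢j′ v vj vj′ → j≢j′ (s-inj (j<M y) (j<M y′) (trans (≡-sym vj) vj′)))
            (AllPairs-resp-⊆ sub uniq)))
        where
        lo<N : lo x < N
        lo<N = <-trans (lo<hi x) (hi<N x)
      few-Lo : ∀ xs → AllPairs (λ x y → lo y ≤ lo x × ¬ (lo x < hi y)) xs →
        ∀ {x} → x ∈ xs → ∀ ys → ys ⊆ xs → All (λ y → Lo y ≤ Lo x × Lo x < Hi y) ys → length ys ≤ ℓ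
      few-Lo xs xs-ap {x} _ ys sub a = <⇒≤
        (K2-minor 1≤ℓ noK (Seg s 0 (suc (Lo x))) (Seg s (suc (Lo x)) M) (λ y v → v ≡ t (c y)) ys
          (seg-conn s-steps 0 _ Lo<M) (seg-conn s-steps _ M ≤-refl) (prefix-suffix-disj S Lo<M)
          (λ {y} y∈ → let (Lo≤ , <Hi) = All.lookup a y∈ in record
            { R-conn = λ { u v refl refl → here refl }
            ; R-A = t (c y) , s (Lo y) , refl , (Lo y , z≤n , s≤s Lo≤ , refl) , c-Lo y
            ; R-B = t (c y) , s (Hi y) , refl , (Hi y , <Hi , Hi<M y , refl) , c-Hi y
            ; A-disj = λ { v (k , _ , k< , vk) vt → S∩T v (k , z≤n , <-≤-trans k< Lo<M , vk) (c y , z≤n , c<N y , vt) }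
            ; B-disj = λ { v (k , _ , k< , vk) vt → S∩T v (k , z≤n , k< , vk) (c y , z≤n , c<N y , vt) } })
          (AllPairs.map (λ {y} {y′} (_ , lo≮hi) v vc vc′ →
              <⇒≢ (<-trans (c<hi y′) (≤-<-trans (≮⇒≥ lo≮hi) (lo<c y)))
                (≡-sym (t-inj (c<N y) (c<N y′) (trans (≡-sym vc) vc′))))
            (AllPairs-resp-⊆ sub xs-ap)))
        where
        Lo<M : Lo x < M
        Lo<M = <-trans (Lo<Hi x) (Hi<M x)
        c<N : ∀ y → c y < N
        c<N y = <-trans (c<hi y) (hi<N y)

    no-clean-positions : (lb ub : ℕ) (ub<N : ub < N)
      (cleanT : ∀ k → lb < k → k < ub → ∀ v → E (t k) v → OnS v ⊎ PathNbr T k v) →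
      (js : List ℕ) → Unique js → All (λ j → j < M × Local.CleanS S∩T lb ub ub<N cleanT j) js →
      rail-bound ℓ ≤ length js → ⊥
    no-clean-positions lb ub ub<N cleanT js uniq clean big =
      collect js clean λ { ws refl → no-windows ws (AllPairsₚ.map⁻ uniq) (≤-trans big (≤-reflexive (length-map Window.j ws))) }
      where
      open Local S∩T lb ub ub<N cleanT
      collect : ∀ js → All (λ j → j < M × CleanS j) js → (∀ ws → map Window.j ws ≡ js → ⊥) → ⊥
      collect [] [] κ = κ [] refl
      collect (j ∷ js) ((j< , cl) ∷ a) κ = window j< cl λ w wj → collect js a λ ws e → κ (w ∷ ws) (cong₂ _∷_ wj e)

-- Numerical bounds and assembly.

degree-bound : ℕ → ℕ
degree-bound ℓ = ℓ * suc (window-bound ℓ * 3)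

-- The last factor makes the neighbours on `S` distinct; up to `ℓ` of them are lost on account of
-- each end of the window, and `rail-bound ℓ` are kept.
window-width : ℕ → ℕ
window-width ℓ = (ℓ + (ℓ + rail-bound ℓ)) * suc (degree-bound ℓ)

-- The summand 2 in `2 + window-width ℓ` makes room for the two ends of a window, whose inner
-- vertices number `window-width ℓ`.
path-bound : ℕ → ℕ
path-bound ℓ = suc (ℓ * suc (window-bound ℓ * (2 + window-width ℓ))) * suc (degree-bound ℓ)

order-bound : ℕ → ℕ
order-bound ℓ = suc (degree-bound ℓ) ^ path-bound ℓ

module Assembly {n : ℕ} (G : Graph n) (k3 : KConnected 3 G) (min5 : MinDegAtLeast 5 G)
  {ℓ : ℕ} (1≤ℓ : 1 ≤ ℓ) (noK : ¬ HasMinor (K2 ℓ) G)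
  (noTwins : ∀ u v → Twins G u v → deg G u ≡ 5 → deg G v ≡ 5 → ⊥) where

  open Basics G
  open Paths G
  open Geodesics G
  open Windows G k3 1≤ℓ noK
  open Nonseparating G k3

  -- The neighbourhood of a vertex of large degree would contain a clean window of some path,
  -- whose inner vertices have degree at most 3.
  bounded-degree : ∀ v → deg G v ≤ degree-bound ℓ
  bounded-degree v = ≮⇒≥ λ big →
    many-terminals-on-geodesic 1≤ℓ noK (_∉ v ∷ []) (_≡ v) (proj₂ k3 (v ∷ []) (s≤s (s≤s z≤n))) cQ
      (λ { w refl w∉ → w∉ (here refl) }) (window-bound ℓ * 3) (nbrs v) (nbrs-unique v)
      (λ x∈ → (λ { (here refl) → E-irrefl (nbrs-E x∈) }) , v , refl , E-sym (nbrs-E x∈))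
      (≤-trans big (≤-reflexive (deg-nbrs v))) λ P inK ks ap enough term →
    let open Path P in
    -- Width 2 leaves exactly one inner vertex, at position `suc x`.
    clean-window P (_≡ v) cQ (λ k k< e → inK k k< (here e)) 2 ks ap term enough λ x _ clean →
    <⇒≱ (min5 (at (suc x))) (≤-trans
      (deg-cover (v ∷ at x ∷ at (2 + x) ∷ [])
        (λ {w} e → local P x w (clean (suc x) ≤-refl (≤-reflexive (+-comm 2 x)) w e)))
      (n≤1+n 3))
    where
    cQ : Conn (_≡ v)
    cQ u w refl refl = here refl
    local : ∀ P x w → w ≡ v ⊎ PathNbr P (suc x) w → w ∈ v ∷ Path.at P x ∷ Path.at P (2 + x) ∷ []
    local P x w (inj₁ refl) = here refl
    local P x w (inj₂ (_ , _ , refl , inj₁ refl)) = there (there (here refl))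
    local P x w (inj₂ (_ , _ , refl , inj₂ refl)) = there (here refl)

  off-path-nbr : ∀ (P : Path) (W : V → Set) k →
    (∀ v → E (Path.at P k) v → ¬ W v → PathNbr P k v) → ¬ ¬ (∃ λ v → W v × E (Path.at P k) v)
  off-path-nbr P W k nbr none = <⇒≱ (min5 (at k)) (≤-trans
    (deg-cover (at (pred k) ∷ at (suc k) ∷ [])
      (λ {w} e → local w (nbr w e (λ Ww → none (w , Ww , e)))))
    (s≤s (s≤s z≤n)))
    where
    open Path P
    local : ∀ w → PathNbr P k w → w ∈ at (pred k) ∷ at (suc k) ∷ []
    local w (_ , _ , refl , inj₁ refl) = there (here refl)
    local w (_ , _ , refl , inj₂ refl) = here refl

  -- A vertex is the chosen neighbour of at most `degree-bound ℓ` positions, so a greedy choice with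
  -- constant weight finds distinct neighbours.
  distinct-nbrs : ∀ (P : Path) (W : V → Set) (is : List ℕ) → Unique is → All (_< Path.len P) is →
    (∀ {i} → i ∈ is → ¬ ¬ (∃ λ v → W v × E (Path.at P i) v)) →
    ∀ k → k * suc (degree-bound ℓ) ≤ length is →
    (∀ vs → Unique vs → length vs ≡ k → All (λ v → W v × ∃ λ i → i ∈ is × E (Path.at P i) v) vs → ⊥) → ⊥
  distinct-nbrs P W is uniq is< nbr k big κ = collect is nbr λ { ps refl sees →
    greedy (λ _ → 0) (λ x y → proj₂ x ≡ proj₂ y) (degree-bound ℓ) k ps
      (λ {x} _ ys sub a → ≤-trans
        (≤-trans (≤-reflexive (≡-sym (length-map (at ∘ proj₁) ys)))
          (unique-length (nbrs (proj₂ x))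
            (AllPairsₚ.map⁺ (AllPairs-map-∈ ys (λ y∈ z∈ ne e →
                ne (inj (All.lookup is< (∈-map⁺ proj₁ (⊆-∈ sub y∈))) (All.lookup is< (∈-map⁺ proj₁ (⊆-∈ sub z∈))) e))
              (AllPairs-resp-⊆ sub (AllPairsₚ.map⁻ uniq))))
            (λ y∈ → let (y , y∈ys , eq) = ∈-map⁻ (at ∘ proj₁) y∈ in
              subst (_∈ nbrs (proj₂ x)) (≡-sym eq) (∈-nbrs (E-sym
                (subst (E (at (proj₁ y))) (≡-sym (proj₂ (All.lookup a y∈ys))) (proj₂ (All.lookup sees (⊆-∈ sub y∈ys)))))))))
        (≤-trans (≤-reflexive (≡-sym (deg-nbrs (proj₂ x)))) (bounded-degree (proj₂ x))))
      (≤-trans big (≤-reflexive (length-map proj₁ ps))) λ ys len≡ ys∈ ap →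
    κ (map proj₂ ys) (AllPairsₚ.map⁺ (AllPairs.map proj₂ ap)) (trans (length-map proj₂ ys) len≡)
      (All.tabulate λ v∈ → let (y , y∈ys , eq) = ∈-map⁻ proj₂ v∈
                               y∈ps = All.lookup ys∈ y∈ys
                               (Wy , e) = All.lookup sees y∈ps in
        subst W (≡-sym eq) Wy , proj₁ y , ∈-map⁺ proj₁ y∈ps , subst (E (at (proj₁ y))) (≡-sym eq) e) }
    where
    open Path P
    collect : ∀ is → (∀ {i} → i ∈ is → ¬ ¬ (∃ λ v → W v × E (at i) v)) →
      (∀ ps → map proj₁ ps ≡ is → All (λ (i , v) → W v × E (at i) v) ps → ⊥) → ⊥
    collect [] nbr κ = κ [] refl []
    collect (i ∷ is) nbr κ = nbr (here refl) λ { (v , Wv , e) → collect is (nbr ∘ there) λ ps eq sees →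
      κ ((i , v) ∷ ps) (cong (i ∷_) eq) ((Wv , e) ∷ sees) }

  module _ (S : Path) (K : V → Set) (cK : Conn K) (off : ∀ k → k < Path.len S → ¬ K (Path.at S k))
    (cover : ∀ w → ¬ Seg (Path.at S) 0 (Path.len S) w → K w) where
    open Path S using () renaming (at to s; len to M; steps to s-steps; inj to s-inj; induced to s-induced)

    OnS : V → Set
    OnS = Seg s 0 M

    cS : Conn OnS
    cS = seg-conn s-steps 0 M ≤-refl

    S∩K : Disj OnS K
    S∩K v (k , _ , k< , refl) = off k k<

    module _ (T : Path) (T⊆K : ∀ k → k < Path.len T → K (Path.at T k)) (x ub : ℕ) (ub< : ub < Path.len T)
      (clean : ∀ k → x < k → k < ub → ∀ v → E (Path.at T k) v → OnS v ⊎ PathNbr T k v) where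
      open Path T using () renaming (at to t; len to N; steps to t-steps)

      S∩T : Disj OnS (Seg t 0 N)
      S∩T v on (k , _ , k< , refl) = S∩K v on (T⊆K k k<)

      InnerT Outer : V → Set
      InnerT = Seg t (suc x) ub
      Outer v = K v × ¬ InnerT v

      -- Keep the part of the walk after its last visit to the inside of the window. As `K` avoids
      -- `S`, cleanness lets the walk leave the inside only through `t x` or `t ub`.
      outer-reach : ∀ {u v} → Reach G K u v → Outer v →
        ¬ ¬ (Reach G Outer u v ⊎ Reach G Outer (t x) v ⊎ Reach G Outer (t ub) v)
      outer-reach (here _) Ov κ = κ (inj₁ (here Ov))
      outer-reach (step {u} {w} Ku e r) Ov κ = outer-reach r Ov λ
        { (inj₂ ends) → κ (inj₂ ends)
        ; (inj₁ r′) → lem (InnerT u) λ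
            { (no ¬in) → κ (inj₁ (step (Ku , ¬in) e r′))
            ; (yes (k , x<k , k<ub , refl)) → exit k x<k k<ub r′ (clean k x<k k<ub w e) } }
        where
        exit : ∀ k → x < k → k < ub → Reach G Outer w _ → OnS w ⊎ PathNbr T k w → ⊥
        exit k x<k k<ub r′ (inj₁ on) = S∩K w on (R-left r)
        exit k x<k k<ub r′ (inj₂ (_ , _ , refl , inj₁ refl)) with m≤n⇒m<n∨m≡n k<ub
        ... | inj₁ lt = proj₂ (R-left r′) (suc k , m<n⇒m<1+n x<k , lt , refl)
        ... | inj₂ refl = κ (inj₂ (inj₂ r′))
        exit k x<k k<ub r′ (inj₂ (j , _ , refl , inj₂ refl)) with m≤n⇒m<n∨m≡n (≤-pred x<k)
        ... | inj₁ lt = proj₂ (R-left r′) (j , lt , <-trans (n<1+n j) k<ub , refl)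
        ... | inj₂ refl = κ (inj₂ (inj₁ r′))

      SeesInner : ℕ → Set
      SeesInner j = j < M × ∃ λ v → InnerT v × E (s j) v

      -- The rails are the inside of the window and one component of the rest of `K`; the vertices
      -- `s j` are the rungs.
      few-see-both : ∀ (c : V) (js : List ℕ) → Unique js → All SeesInner js →
        All (λ j → ∃ λ v → Reach G Outer c v × E (s j) v) js → length js ≤ ℓ
      few-see-both c js uniq inner outer = <⇒≤
        (K2-minor 1≤ℓ noK (Reach G Outer c) InnerT (λ j v → v ≡ s j) js comp-conn
          (seg-conn t-steps (suc x) ub (<⇒≤ ub<)) (λ v r → proj₂ (R-right r))
          (λ {j} j∈ → let (j< , v , Iv , e) = All.lookup inner j∈
                          (v′ , r , e′) = All.lookup outer j∈ in record
            { R-conn = λ { u v refl refl → here refl }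
            ; R-A = s j , v′ , refl , r , e′
            ; R-B = s j , v , refl , Iv , e
            ; A-disj = λ { w r refl → off j j< (proj₁ (R-right r)) }
            ; B-disj = λ { w (k , _ , k< , eq) refl → S∩T w (j , z≤n , j< , refl) (k , z≤n , <-trans k< ub< , eq) } })
          (AllPairs-map-∈ js (λ { i∈ j∈ i≢j v refl eq →
            i≢j (s-inj (proj₁ (All.lookup inner i∈)) (proj₁ (All.lookup inner j∈)) eq) }) uniq))

      -- All of `K` outside the window's interior is reached from `t x` or from `t ub`. Discarding
      -- the few positions of `S` that see either component leaves positions that see only the
      -- inside of the window.
      no-wide-window : x ≤ ub → suc (window-width ℓ) + x ≡ ub → ⊥
      no-wide-window x≤ub refl =
        distinct-nbrs T OnS is (AllPairsₚ.applyUpTo⁺₁ _ _ (λ i<j _ e → <⇒≢ i<j (+-cancelʳ-≡ x _ _ (suc-injective e))))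
          (All.tabulate λ i∈ → <-trans (proj₂ (range i∈)) ub<)
          (λ i∈ → let (x<i , i<ub) = range i∈ in
            off-path-nbr T OnS _ λ v e ¬on → [ (λ on → ⊥-elim (¬on on)) , id ]′ (clean _ x<i i<ub v e))
          (ℓ + (ℓ + rail-bound ℓ)) (≤-reflexive (≡-sym (length-applyUpTo _ _))) λ vs uniq len≡ vs-nbr →
        let (js , js≡ , js-inner) = positions vs vs-nbr
            js-uniq = AllPairs.map (λ ne e → ne (cong s e)) (AllPairsₚ.map⁻ (subst Unique (≡-sym js≡) uniq))
            js-len = trans (≡-sym len≡) (trans (cong length (≡-sym js≡)) (length-map s js)) in
        prune (λ j → ∃ λ v → Reach G Outer (t x) v × E (s j) v) ℓ (ℓ + rail-bound ℓ) js (≤-reflexive js-len)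
          (λ ys sub → few-see-both (t x) ys (AllPairs-resp-⊆ sub js-uniq) (All-resp-⊆ sub js-inner)) λ ks k⊆ ¬left ks-len →
        prune (λ j → ∃ λ v → Reach G Outer (t ub) v × E (s j) v) ℓ (rail-bound ℓ) ks ks-len
          (λ ys sub → few-see-both (t ub) ys (AllPairs-resp-⊆ (⊆-trans sub k⊆) js-uniq) (All-resp-⊆ (⊆-trans sub k⊆) js-inner))
          λ ls l⊆ ¬right ls-len →
        decAll OnS λ OnS? → decAll InnerT λ In? →
        TwoRails.no-clean-positions G min5 1≤ℓ noK noTwins S T S∩T x ub ub< clean ls
          (AllPairs-resp-⊆ (⊆-trans l⊆ k⊆) js-uniq)
          (All.tabulate λ {j} j∈ → let j< = proj₁ (All.lookup js-inner (⊆-∈ (⊆-trans l⊆ k⊆) j∈)) in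
            j< , λ v e → local j< e (OnS? v) (In? v)
              (λ r → All.lookup ¬left (⊆-∈ l⊆ j∈) (v , r , e)) (λ r → All.lookup ¬right j∈ (v , r , e)))
          ls-len
        where
        is : List ℕ
        is = applyUpTo (λ i → suc (i + x)) (window-width ℓ)
        range : ∀ {i} → i ∈ is → x < i × i < ub
        range i∈ with ∈-applyUpTo⁻ _ i∈
        ... | k , k< , refl = s≤s (m≤n+m x k) , s≤s (+-monoˡ-< x k<)
        positions : ∀ vs → All (λ v → OnS v × ∃ λ i → i ∈ is × E (t i) v) vs →
          ∃ λ js → map s js ≡ vs × All SeesInner js
        positions [] [] = [] , refl , []
        positions (v ∷ vs) (((j , _ , j< , refl) , i , i∈ , e) ∷ a) =
          let (js , eq , b) = positions vs a in
          j ∷ js , cong (s j ∷_) eq ,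
          (j< , t i , (i , proj₁ (range i∈) , proj₂ (range i∈) , refl) , E-sym e) ∷ b
        x< : x < N
        x< = ≤-<-trans x≤ub ub<
        local : ∀ {j v} → j < M → E (s j) v → Dec (OnS v) → Dec (InnerT v) →
          ¬ Reach G Outer (t x) v → ¬ Reach G Outer (t ub) v →
          (∃ λ k → x < k × k < ub × v ≡ t k) ⊎ PathNbr S j v
        local j< e (yes (k , _ , k< , refl)) _ _ _ = inj₂ (k , k< , refl , s-induced j< k< e)
        local j< e (no _) (yes (k , x<k , k<ub , eq)) _ _ = inj₁ (k , x<k , k<ub , eq)
        local {v = v} j< e (no ¬on) (no ¬in) ¬l ¬r = ⊥-elim
          (outer-reach (cK (t x) v (T⊆K x x<) (cover v ¬on)) (cover v ¬on , ¬in)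
            [ ¬l , [ ¬l , ¬r ]′ ]′)

    -- Each vertex of `S` has a neighbour in `K`, and bounded degrees make many of these distinct.
    -- Some geodesic of `K` carries many of them, hence has a wide clean window with respect to `S`.
    no-long-path : path-bound ℓ ≤ M → ⊥
    no-long-path long =
      distinct-nbrs S K (upTo M) (Uniqueₚ.upTo⁺ M) (All.tabulate ∈-upTo⁻)
        (λ {i} i∈ κ → decAll OnS λ OnS? → off-path-nbr S K i
          (λ v e ¬K → local (∈-upTo⁻ i∈) e ¬K (OnS? v)) κ)
        (suc (ℓ * suc (window-bound ℓ * (2 + window-width ℓ)))) (≤-trans long (≤-reflexive (≡-sym (length-upTo M))))
        λ vs uniq len≡ vs-nbr →
      many-terminals-on-geodesic 1≤ℓ noK K OnS cK cS S∩K (window-bound ℓ * (2 + window-width ℓ)) vs uniq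
        (λ v∈ → let (Kv , i , i∈ , e) = All.lookup vs-nbr v∈ in
          Kv , s i , (i , z≤n , ∈-upTo⁻ i∈ , refl) , E-sym e)
        (≤-reflexive (≡-sym len≡)) λ T T⊆K ks ap enough term →
      clean-window T OnS cS (λ k k< on → S∩K _ on (T⊆K k k<)) (suc (window-width ℓ)) ks ap term enough λ x ub< clean →
      no-wide-window T T⊆K x (x + suc (window-width ℓ)) ub< clean (m≤m+n x _) (+-comm _ x)
      where
      local : ∀ {i v} → i < M → E (s i) v → ¬ K v → Dec (OnS v) → PathNbr S i v
      local i< e ¬K (yes (k , _ , k< , refl)) = k , k< , refl , s-induced i< k< e
      local i< e ¬K (no ¬on) = ⊥-elim (¬K (cover _ ¬on))

  bounded-order : n ≤ order-bound ℓ
  bounded-order = ≮⇒≥ λ big → far-vertex (degree-bound ℓ) (path-bound ℓ) bounded-degree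
    (λ v → whole r v (λ ()) (λ ())) big λ v d far D →
    lem (∃ λ w → w ≢ r × w ≢ v) λ
      -- 3-connectivity includes `3 < n`, so there is a third vertex from which to grow `K`.
      { (no none) → <⇒≱ (proj₁ k3) (≤-trans (≤-reflexive (≡-sym (length-tabulate {n = n} id)))
          (≤-trans (unique-length (r ∷ v ∷ []) (Uniqueₚ.allFin⁺ n) (λ {w} _ → cover₂ v none w)) (n≤1+n 2)))
      ; (yes (w , w≢r , w≢v)) →
        nonseparating-path n (w ∷ []) ([] ∷ []) (n≤1+n n) (w , here refl)
          (λ { a b (here refl) (here refl) → here (here refl) })
          (proj₂ k3 (w ∷ []) (s≤s (s≤s z≤n)) r v (λ { (here e) → w≢r (≡-sym e) }) (λ { (here e) → w≢v (≡-sym e) }))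
          λ { P K start (d′ , len≡ , end) cK off cover →
            no-long-path P K cK off cover
              -- The path is a walk from `r` to `v`, so it is no shorter than their distance.
              (≤-trans (<⇒≤ far) (≤-trans (≮⇒≥ (λ d′<d → proj₂ D d′ d′<d
                (subst (Walk d′) end (walks P start d′ (≤-reflexive (≡-sym len≡))))))
                (≤-trans (n≤1+n d′) (≤-reflexive (≡-sym len≡))))) } }
    where
    r : V
    r = fromℕ< (proj₁ k3)
    whole : Conn (_∉ [])
    whole = proj₂ k3 [] (s≤s z≤n)
    open From (_∉ []) r
    cover₂ : ∀ v → ¬ (∃ λ w → w ≢ r × w ≢ v) → ∀ w → w ∈ r ∷ v ∷ []
    cover₂ v none w with w ≟ᶠ r | w ≟ᶠ v
    ... | yes e | _ = here e
    ... | no _ | yes e = there (here e)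
    ... | no w≢r | no w≢v = ⊥-elim (none (w , w≢r , w≢v))
    walks : ∀ P → Path.at P 0 ≡ r → ∀ k → k < Path.len P → Walk k (Path.at P k)
    walks P start zero _ = start
    walks P start (suc k) k< = (λ ()) , Path.at P k , walks P start k (<-trans (n<1+n k) k<) , Path.steps P k k<

theorem1 : (ℓ : ℕ) → 1 ≤ ℓ →
    Σ ℕ λ N → (n : ℕ) (G : Graph n) →
    KConnected 3 G →
    MinDegAtLeast 5 G →
    ¬ HasMinor (K2 ℓ) G →
    (∀ u v → Twins G u v → deg G u ≡ 5 → deg G v ≡ 5 → ⊥) →
    n ≤ N
theorem1 ℓ 1≤ℓ = order-bound ℓ , λ n G k3 min5 noK noTwins →
  Assembly.bounded-order G k3 min5 1≤ℓ noK noTwins
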